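{- Let $n \ge 2$ be an integer. There exists an exponential orthomorphism modulo $n$ if and only if $n = 2$, $n = 3$, $n = 4$, or $n = 2p$ where $p$ is an odd prime such that $p - 1 = 2 q_1 q_2 \cdots q_k$ for some $k \ge 0$ and distinct odd primes $q_1, \dots, q_k$.
   Context: For an integer $n \ge 2$, an exponential orthomorphism modulo $n$ is a permutation $\sigma$ of $\{1, \dots, n-1\}$ such that the map $x \mapsto x^{\sigma(x)} \bmod n$ is also a bijection of $\{1, \dots, n-1\}$ (residues taken in $\{0,\dots,n-1\}$). -}

module Defs where

open import Data.Nat using (ℕ; _*_; _^_; _∸_; _≤_; _<_; NonZero)
open import Data.Nat.DivMod using (_%_)
open import Data.Nat.Primality using (Prime)
open import Data.Nat.Divisibility using (_∣_)
open import Data.List using (List)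
open import Data.Nat.ListAction using (product)
open import Data.Sum using (_⊎_)
open import Data.List.Relation.Unary.All using (All)
open import Data.List.Relation.Unary.Unique.Propositional using (Unique)
open import Data.Product using (_×_; Σ; ∃-syntax)
open import Relation.Binary.PropositionalEquality using (_≡_)
open import Relation.Nullary using (¬_)

InRange : ℕ → ℕ → Set
InRange n x = 1 ≤ x × x < n

BijOn : ℕ → (ℕ → ℕ) → Set
BijOn n f =
  (∀ x → InRange n x → InRange n (f x)) ×
  (∀ x y → InRange n x → InRange n y → f x ≡ f y → x ≡ y) ×
  (∀ y → InRange n y → ∃[ x ] (InRange n x × f x ≡ y))

-- σ is an exponential orthomorphism modulo n (only its values on {1,…,n-1} matter)
IsExpOrthomorphism : (n : ℕ) .{{_ : NonZero n}} → (ℕ → ℕ) → Set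
IsExpOrthomorphism n σ = BijOn n σ × BijOn n (λ x → (x ^ σ x) % n)

ExistsExpOrthomorphism : (n : ℕ) .{{_ : NonZero n}} → Set
ExistsExpOrthomorphism n = ∃[ σ ] IsExpOrthomorphism n σ

Odd : ℕ → Set
Odd m = ¬ (2 ∣ m)

GoodPrimeShape : ℕ → Set
GoodPrimeShape p =
  ∃[ qs ] (All Prime qs × All Odd qs × Unique qs × p ∸ 1 ≡ 2 * product qs)

Admissible : ℕ → Set
Admissible n = n ≡ 2 ⊎ (n ≡ 3 ⊎ (n ≡ 4 ⊎ ∃[ p ] (Prime p × Odd p × GoodPrimeShape p × n ≡ 2 * p)))

{-# OPTIONS --safe #-}
module Submission where

{-
Write f(x) = x^σ(x) mod n. A subset of the residues that f maps into itself is mapped onto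
itself, and this is applied to sets defined by divisibility and power residue conditions.

Necessity. If p² ∣ n, then p and n − p can only be values at points with exponent 1, so they
coincide and n = 4. If two distinct odd primes divide n, there are fewer nonzero squares than
even exponents, although even exponents give squares. If p ∣ n and r² ∣ p − 1, the points whose
exponent is divisible by r all have r²-th power residues modulo p (or 0) as values, and there are
too few of these. Finally, if n > 3 is prime, pick an odd prime q ∣ n − 1; the subgroup of order q gives a permutation κ of
ℤ/q for which i ↦ i κ(i) is a permutation too, so W² = W for W = (q − 1)!, against Wilson's theorem.

Sufficiency. For n = 2p and m = p − 1 a nonzero residue is p or a pair (a, e) of a discrete
logarithm modulo m and a parity, and every exponent modulo m occurs twice. So one needs a
permutation (a, e) ↦ (b, t) of ℤ/m × {0, 1} such that a ↦ ab permutes ℤ/m for each e. By the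
Chinese remainder theorem it is enough to have it for prime m = q. There b = ±(1 + 1/a), with
the sign depending on e, works after a correction at a = 0 and a = −1.
-}

open import Defs
open import Data.Bool using (Bool; true; false; not; _xor_; if_then_else_)
open import Data.Empty using (⊥; ⊥-elim)
open import Data.List using (List; []; _∷_; _++_; [_]; _∷ʳ_; map; length; filter; upTo; applyUpTo; cartesianProduct)
open import Data.List.Membership.Propositional using (_∈_; find)
open import Data.List.Membership.Propositional.Properties
open import Data.List.Properties
  using (length-map; length-++; length-applyUpTo; length-upTo; map-id; map-++; map-applyUpTo; applyUpTo-∷ʳ)
open import Data.List.Relation.Binary.Permutation.Propositional using (_↭_; ↭-refl; ↭-sym; ↭-trans; prep)
open import Data.List.Relation.Binary.Permutation.Propositional.Properties using (↭-length; shift; ∈-resp-↭)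
open import Data.List.Relation.Binary.Subset.Propositional using (_⊆_)
open import Data.List.Relation.Unary.All as All using (All; []; _∷_)
import Data.List.Relation.Unary.All.Properties as All
open import Data.List.Relation.Unary.AllPairs using ([]; _∷_)
open import Data.List.Relation.Unary.Any using (here; there)
open import Data.List.Relation.Unary.Unique.Propositional using (Unique)
import Data.List.Relation.Unary.Unique.Propositional.Properties as Unique
open import Data.Nat
open import Data.Nat.Coprimality using (Coprime; coprime-divisor; coprime-Bézout)
open import Data.Nat.Divisibility
open import Data.Nat.DivMod
open import Data.Nat.GCD using (module Bézout)
open import Data.Nat.ListAction using (product)
open import Data.Nat.ListAction.Properties using (product-↭; product-++; ∈⇒∣product)
open import Data.Nat.Primality
open import Data.Nat.Primality.Factorisation using (PrimeFactorisation; factorise; factorisationHasAllPrimeFactors)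
open import Data.Nat.Properties
open import Data.Nat.Tactic.RingSolver using (solve-∀)
open import Data.Product using (_×_; _,_; proj₁; proj₂; ∃-syntax)
open import Data.Sum using (_⊎_; inj₁; inj₂; [_,_]′)
open import Function using (_∘_)
open import Function.Bundles using (_⇔_; mk⇔)
open import Level using (Level)
open import Relation.Binary.Bundles using (Setoid)
open import Relation.Binary.Consequences using (wlog)
open import Relation.Binary.PropositionalEquality hiding ([_])
open import Relation.Nullary
open import Relation.Nullary.Decidable using (map′; dec-true; dec-false; _⊎-dec_; _×-dec_)
open import Relation.Unary using (Decidable)

-- Congruences of natural numbers and divisibility by primes

infix 4 _≈_mod_ _≈?_mod_

-- Multiples of the modulus may be added on both sides, so congruence is expressed without
-- subtraction and its rules reduce to semiring identities.
record _≈_mod_ (a b n : ℕ) : Set where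
  constructor balance
  field
    leftMultiple rightMultiple : ℕ
    balanced : a + leftMultiple * n ≡ b + rightMultiple * n

≈-refl : ∀ {n a} → a ≈ a mod n
≈-refl = balance 0 0 refl

≈-reflexive : ∀ {n a b} → a ≡ b → a ≈ b mod n
≈-reflexive refl = ≈-refl

≈-sym : ∀ {n a b} → a ≈ b mod n → b ≈ a mod n
≈-sym (balance k l e) = balance l k (sym e)

≈-trans : ∀ {n a b c} → a ≈ b mod n → b ≈ c mod n → a ≈ c mod n
≈-trans {n} {a} {b} {c} (balance k l e) (balance k′ l′ e′) = balance (k + k′) (l′ + l) (begin
  a + (k + k′) * n       ≡⟨ split a k k′ n ⟩
  (a + k * n) + k′ * n   ≡⟨ cong (_+ k′ * n) e ⟩
  (b + l * n) + k′ * n   ≡⟨ exchange b l k′ n ⟩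
  (b + k′ * n) + l * n   ≡⟨ cong (_+ l * n) e′ ⟩
  (c + l′ * n) + l * n   ≡⟨ split c l′ l n ⟨
  c + (l′ + l) * n       ∎)
  where
  open ≡-Reasoning
  split : ∀ a k l n → a + (k + l) * n ≡ (a + k * n) + l * n
  split = solve-∀
  exchange : ∀ a k l n → (a + k * n) + l * n ≡ (a + l * n) + k * n
  exchange = solve-∀

≈-setoid : ℕ → Setoid _ _
≈-setoid n = record
  { Carrier       = ℕ
  ; _≈_           = _≈_mod n
  ; isEquivalence = record { refl = ≈-refl ; sym = ≈-sym ; trans = ≈-trans }
  }

module ≈-Reasoning (n : ℕ) where
  open import Relation.Binary.Reasoning.Setoid (≈-setoid n) public

+-≈ : ∀ {n a b c d} → a ≈ b mod n → c ≈ d mod n → a + c ≈ b + d mod n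
+-≈ {n} {a} {b} {c} {d} (balance k l e) (balance k′ l′ e′) = balance (k + k′) (l + l′)
  (trans (split a c k k′ n) (trans (cong₂ _+_ e e′) (sym (split b d l l′ n))))
  where
  split : ∀ a c k k′ n → a + c + (k + k′) * n ≡ (a + k * n) + (c + k′ * n)
  split = solve-∀

*-≈ : ∀ {n a b c d} → a ≈ b mod n → c ≈ d mod n → a * c ≈ b * d mod n
*-≈ {n} {a} {b} {c} {d} (balance k l e) (balance k′ l′ e′) =
  balance (a * k′ + k * c + k * k′ * n) (b * l′ + l * d + l * l′ * n)
  (trans (split a c k k′ n) (trans (cong₂ _*_ e e′) (sym (split b d l l′ n))))
  where
  split : ∀ a c k k′ n → a * c + (a * k′ + k * c + k * k′ * n) * n ≡ (a + k * n) * (c + k′ * n)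
  split = solve-∀

*-≈ˡ : ∀ {n} a {c d} → c ≈ d mod n → a * c ≈ a * d mod n
*-≈ˡ a = *-≈ {a = a} ≈-refl

^-≈ : ∀ {n a b} k → a ≈ b mod n → a ^ k ≈ b ^ k mod n
^-≈ zero    e = ≈-refl
^-≈ (suc k) e = *-≈ e (^-≈ k e)

+-cancelˡ-≈ : ∀ {n} c {a b} → c + a ≈ c + b mod n → a ≈ b mod n
+-cancelˡ-≈ {n} c {a} {b} (balance k l e) = balance k l
  (+-cancelˡ-≡ c _ _ (trans (sym (+-assoc c a (k * n))) (trans e (+-assoc c b (l * n)))))

≈0⇒∣ : ∀ {n a} → a ≈ 0 mod n → n ∣ a
≈0⇒∣ {n} {a} (balance k l e) = ∣m+n∣m⇒∣n (subst (n ∣_) (trans (sym e) (+-comm a (k * n))) (n∣m*n l)) (n∣m*n k)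

∣⇒≈0 : ∀ {n a} → n ∣ a → a ≈ 0 mod n
∣⇒≈0 {n} {a} (divides q e) = balance 0 q (trans (+-identityʳ a) e)

∣-resp-≈ : ∀ {n a b} → a ≈ b mod n → n ∣ a → n ∣ b
∣-resp-≈ a≈b n∣a = ≈0⇒∣ (≈-trans (≈-sym a≈b) (∣⇒≈0 n∣a))

≈-self : ∀ {n} → n ≈ 0 mod n
≈-self = ∣⇒≈0 ∣-refl

≈-weaken : ∀ {d n a b} → d ∣ n → a ≈ b mod n → a ≈ b mod d
≈-weaken {d} {_} {a} {b} (divides q refl) (balance k l e) =
  balance (k * q) (l * q) (trans (cong (a +_) (*-assoc k q d)) (trans e (cong (b +_) (sym (*-assoc l q d)))))

≈⇒% : ∀ {n a b} .{{_ : NonZero n}} → a ≈ b mod n → a % n ≡ b % n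
≈⇒% {n} {a} {b} (balance k l e) =
  trans (sym ([m+kn]%n≡m%n a k n)) (trans (cong (_% n) e) ([m+kn]%n≡m%n b l n))

%-≈ : ∀ a n .{{_ : NonZero n}} → a % n ≈ a mod n
%-≈ a n = balance (a / n) 0 (trans (sym (m≡m%n+[m/n]*n a n)) (sym (+-identityʳ a)))

%⇒≈ : ∀ {n a b} .{{_ : NonZero n}} → a % n ≡ b % n → a ≈ b mod n
%⇒≈ {n} {a} {b} e = ≈-trans (≈-sym (%-≈ a n)) (≈-trans (≈-reflexive e) (%-≈ b n))

≈⇒≡ : ∀ {n a b} → a < n → b < n → a ≈ b mod n → a ≡ b
≈⇒≡ {n} a<n b<n e = trans (sym (m<n⇒m%n≡m a<n)) (trans (≈⇒% e) (m<n⇒m%n≡m b<n))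
  where instance _ = >-nonZero (m<n⇒0<n a<n)

≈+⇒∣ : ∀ {n} a {x} → a ≈ a + x mod n → n ∣ x
≈+⇒∣ a e = ≈0⇒∣ (≈-sym (+-cancelˡ-≈ a (≈-trans (≈-reflexive (+-identityʳ a)) e)))

∣⇒≈+ : ∀ {n} a {x} → n ∣ x → a ≈ a + x mod n
∣⇒≈+ a d = ≈-trans (≈-reflexive (sym (+-identityʳ a))) (+-≈ ≈-refl (≈-sym (∣⇒≈0 d)))

-- Replaces the difference of two numbers: on a pair a, a + x a congruence becomes the divisibility
-- `n ∣ x`, and symmetry covers the other order.
wlog-+ : ∀ {ℓ} (R : ℕ → ℕ → Set ℓ) → (∀ {a b} → R a b → R b a) → (∀ a x → R a (a + x)) → ∀ a b → R a b
wlog-+ R symm step = wlog ≤-total symm λ a b a≤b → subst (R a) (m+[n∸m]≡n a≤b) (step a (b ∸ a))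

*-cancelˡ-≈ : ∀ {n} c → (∀ {x} → n ∣ c * x → n ∣ x) → ∀ a b → c * a ≈ c * b mod n → a ≈ b mod n
*-cancelˡ-≈ {n} c cancel = wlog-+ _ (λ f e → ≈-sym (f (≈-sym e))) λ a x e →
  ∣⇒≈+ a (cancel (≈+⇒∣ (c * a) (≈-trans e (≈-reflexive (*-distribˡ-+ c a x)))))

coprime-*-∣ : ∀ {m n x} → Coprime m n → m ∣ x → n ∣ x → m * n ∣ x
coprime-*-∣ {m} {n} c (divides q refl) n∣x =
  subst (_∣ q * m) (*-comm n m) (*-monoˡ-∣ m (coprime-divisor (λ (a , b) → c (b , a)) (subst (n ∣_) (*-comm q m) n∣x)))

≈-crt : ∀ {m n} → Coprime m n → ∀ a b → a ≈ b mod m → a ≈ b mod n → a ≈ b mod (m * n)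
≈-crt c = wlog-+ _ (λ f e e′ → ≈-sym (f (≈-sym e) (≈-sym e′))) λ a x e e′ →
  ∣⇒≈+ a (coprime-*-∣ c (≈+⇒∣ a e) (≈+⇒∣ a e′))

prime-cancel : ∀ {p c} → Prime p → ¬ (p ∣ c) → ∀ {a b} → c * a ≈ c * b mod p → a ≈ b mod p
prime-cancel {p} {c} pr p∤c {a} {b} = *-cancelˡ-≈ c cancel a b
  where
  cancel : ∀ {x} → p ∣ c * x → p ∣ x
  cancel {x} d with euclidsLemma c x pr d
  ... | inj₁ p∣c = ⊥-elim (p∤c p∣c)
  ... | inj₂ p∣x = p∣x

_≈?_mod_ : ∀ a b n .{{_ : NonZero n}} → Dec (a ≈ b mod n)
a ≈? b mod n = map′ %⇒≈ ≈⇒% (a % n ≟ b % n)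

∣-^ : ∀ {p x} k → 0 < k → p ∣ x → p ∣ x ^ k
∣-^ {x = x} (suc k) _ p∣x = ∣m⇒∣m*n (x ^ k) p∣x

prime>1 : ∀ {p} → Prime p → 1 < p
prime>1 {p} pr = nonTrivial⇒n>1 p {{prime⇒nonTrivial pr}}

prime∤1 : ∀ {p} → Prime p → ¬ (p ∣ 1)
prime∤1 pr p∣1 = ¬prime[1] (subst Prime (∣1⇒≡1 p∣1) pr)

prime∤^ : ∀ {p x} → Prime p → ¬ (p ∣ x) → ∀ k → ¬ (p ∣ x ^ k)
prime∤^ pr p∤x zero    d = prime∤1 pr d
prime∤^ pr p∤x (suc k) d = [ p∤x , prime∤^ pr p∤x k ]′ (euclidsLemma _ _ pr d)

prime∤⇒coprime : ∀ {q k} → Prime q → ¬ (q ∣ k) → Coprime q k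
prime∤⇒coprime {q} pr q∤k (d∣q , d∣k) with prime⇒irreducible pr d∣q
... | inj₁ d≡1  = d≡1
... | inj₂ refl = ⊥-elim (q∤k d∣k)

-- Injections and permutations of finite lists

private
  variable
    a b : Level
    A : Set a
    B : Set b

InjectiveOn : List A → (A → B) → Set _
InjectiveOn xs f = ∀ {x y} → x ∈ xs → y ∈ xs → f x ≡ f y → x ≡ y

private
  remove : {xs ys : List A} {x : A} → All (x ≢_) xs → x ∷ xs ⊆ ys → ∃[ zs ] (ys ↭ x ∷ zs × xs ⊆ zs)
  remove {xs = xs} {x = x} x∉xs sub with ∈-∃++ (sub (here refl))
  ... | us , vs , refl = us ++ vs , shift x us vs , λ {y} y∈ → elsewhere y∈ (∈-resp-↭ (shift x us vs) (sub (there y∈)))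
    where
    elsewhere : ∀ {y} → y ∈ xs → y ∈ x ∷ us ++ vs → y ∈ us ++ vs
    elsewhere y∈ (here refl) = ⊥-elim (All.lookup x∉xs y∈ refl)
    elsewhere y∈ (there z) = z

⊆⇒length≤ : {xs ys : List A} → Unique xs → xs ⊆ ys → length xs ≤ length ys
⊆⇒length≤ [] sub = z≤n
⊆⇒length≤ (x∉xs ∷ u) sub with remove x∉xs sub
... | zs , ys↭ , sub′ = subst (_ ≤_) (sym (↭-length ys↭)) (s≤s (⊆⇒length≤ u sub′))

⊆⇒↭ : {xs ys : List A} → Unique xs → xs ⊆ ys → length ys ≤ length xs → xs ↭ ys
⊆⇒↭ {ys = []}    [] sub len = ↭-refl
⊆⇒↭ (x∉xs ∷ u) sub len with remove x∉xs sub
... | zs , ys↭ , sub′ =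
  ↭-trans (prep _ (⊆⇒↭ u sub′ (s≤s⁻¹ (subst (_≤ _) (↭-length ys↭) len)))) (↭-sym ys↭)

map-unique : {xs : List A} {f : A → B} → Unique xs → InjectiveOn xs f → Unique (map f xs)
map-unique [] inj = []
map-unique (x∉xs ∷ u) inj =
  All.map⁺ (All.tabulate λ y∈ e → All.lookup x∉xs y∈ (inj (here refl) (there y∈) e))
  ∷ map-unique u λ x∈ y∈ → inj (there x∈) (there y∈)

map-⊆ : {xs : List A} {ys : List B} {f : A → B} → (∀ {x} → x ∈ xs → f x ∈ ys) → map f xs ⊆ ys
map-⊆ {f = f} maps y∈ with ∈-map⁻ f y∈
... | x , x∈ , refl = maps x∈

map-↭ : {xs : List A} {f : A → A} → Unique xs → (∀ {x} → x ∈ xs → f x ∈ xs) → InjectiveOn xs f → map f xs ↭ xs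
map-↭ {xs = xs} {f} u maps inj =
  ⊆⇒↭ (map-unique u inj) (map-⊆ maps) (≤-reflexive (sym (length-map f xs)))

injective⇒surjective : {xs : List A} {ys : List B} {f : A → B} → Unique xs → (∀ {x} → x ∈ xs → f x ∈ ys) →
  InjectiveOn xs f → length ys ≤ length xs → ∀ {y} → y ∈ ys → ∃[ x ] (x ∈ xs × y ≡ f x)
injective⇒surjective {xs = xs} {f = f} u maps inj len y∈ = ∈-map⁻ f (∈-resp-↭ (↭-sym
  (⊆⇒↭ (map-unique u inj) (map-⊆ maps) (≤-trans len (≤-reflexive (sym (length-map f xs)))))) y∈)

-- On the sublist of elements satisfying `P`, `f` is an injection of a finite set into itself, hence
-- onto. So `f x` has a preimage in that sublist, which by injectivity is `x`. This turns
-- preservation of a property by an orthomorphism into its converse.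
reflects : {xs : List A} {f : A → A} {P : A → Set b} → Decidable P → Unique xs → (∀ {x} → x ∈ xs → f x ∈ xs) →
  InjectiveOn xs f → (∀ {x} → x ∈ xs → P x → P (f x)) → ∀ {x} → x ∈ xs → P (f x) → P x
reflects {xs = xs} {f} {P} P? u maps inj pres {x} x∈ Pfx
  with injective⇒surjective {f = f} (Unique.filter⁺ P? u) maps′
         (λ x∈ y∈ → inj (proj₁ (∈-filter⁻ P? x∈)) (proj₁ (∈-filter⁻ P? y∈))) ≤-refl (∈-filter⁺ P? (maps x∈) Pfx)
  where
  maps′ : ∀ {x} → x ∈ filter P? xs → f x ∈ filter P? xs
  maps′ x∈ with ∈-filter⁻ P? x∈
  ... | x∈xs , Px = ∈-filter⁺ P? (maps x∈xs) (pres x∈xs Px)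
... | y , y∈ , fx≡fy with ∈-filter⁻ P? y∈
... | y∈xs , Py = subst P (sym (inj x∈ y∈xs fx≡fy)) Py

range : ℕ → List ℕ
range n = applyUpTo suc (n ∸ 1)

∈-range⁺ : ∀ {n x} → InRange n x → x ∈ range n
∈-range⁺ {suc n} {suc x} (_ , s≤s x<n) = ∈-applyUpTo⁺ suc x<n

∈-range⁻ : ∀ {n x} → x ∈ range n → InRange n x
∈-range⁻ {suc n} x∈ with ∈-applyUpTo⁻ suc x∈
... | i , i<n , refl = s≤s z≤n , s≤s i<n

range-unique : ∀ n → Unique (range n)
range-unique n = Unique.applyUpTo⁺₁ suc (n ∸ 1) λ i<j _ e → <⇒≢ i<j (suc-injective e)

length-range : ∀ n → length (range n) ≡ n ∸ 1
length-range n = length-applyUpTo suc (n ∸ 1)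

injective⇒BijOn : ∀ {n f} → (∀ x → InRange n x → InRange n (f x)) →
  (∀ x y → InRange n x → InRange n y → f x ≡ f y → x ≡ y) → BijOn n f
injective⇒BijOn {n} {f} maps inj = maps , inj , λ y y∈ → surj y∈
  where
  surj : ∀ {y} → InRange n y → ∃[ x ] (InRange n x × f x ≡ y)
  surj y∈ with injective⇒surjective {f = f} (range-unique n) (λ x∈ → ∈-range⁺ (maps _ (∈-range⁻ x∈)))
                 (λ x∈ y∈ → inj _ _ (∈-range⁻ x∈) (∈-range⁻ y∈)) ≤-refl (∈-range⁺ y∈)
  ... | x , x∈ , e = x , ∈-range⁻ x∈ , sym e

product-map-≈ : ∀ {n} (xs : List A) {f g : A → ℕ} → (∀ {x} → x ∈ xs → f x ≈ g x mod n) →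
  product (map f xs) ≈ product (map g xs) mod n
product-map-≈ []       e = ≈-refl
product-map-≈ (x ∷ xs) e = *-≈ (e (here refl)) (product-map-≈ xs (e ∘ there))

product-map-* : (xs : List A) (f g : A → ℕ) →
  product (map (λ x → f x * g x) xs) ≡ product (map f xs) * product (map g xs)
product-map-* []       f g = refl
product-map-* (x ∷ xs) f g = trans (cong (f x * g x *_) (product-map-* xs f g)) ([m*n]*[o*p]≡[m*o]*[n*p] (f x) (g x) _ _)

product-map-const : (xs : List A) (c : ℕ) → product (map (λ _ → c) xs) ≡ c ^ length xs
product-map-const []       c = refl
product-map-const (x ∷ xs) c = cong (c *_) (product-map-const xs c)

product-map-↭ : {xs : List ℕ} {f : ℕ → ℕ} → Unique xs → (∀ {x} → x ∈ xs → f x ∈ xs) → InjectiveOn xs f →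
  product (map f xs) ≡ product xs
product-map-↭ u maps inj = product-↭ (map-↭ u maps inj)

-- Roots of unity and orders modulo a prime

-- Horner form with natural coefficients: the leading coefficient 1 is built in, and a negative
-- coefficient is entered as a residue modulo p.
data Monic : ℕ → Set where
  one   : Monic 0
  _·X+_ : ∀ {n} → Monic n → ℕ → Monic (suc n)

eval : ∀ {n} → Monic n → ℕ → ℕ
eval one       x = 1
eval (f ·X+ c) x = eval f x * x + c

-- Synthetic division: the intermediate Horner values at a are the coefficients of the quotient of
-- f(X) - f(a) by X - a.
deflate : ∀ {n} → Monic (suc n) → ℕ → Monic n
deflate (one ·X+ c) a          = one
deflate (f@(_ ·X+ _) ·X+ c) a  = deflate f a ·X+ eval f a

-- f(x) − f(a) = (x − a) q(x), with the negative terms moved across.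
eval-deflate : ∀ {n} (f : Monic (suc n)) a x →
  eval f x + a * eval (deflate f a) x ≡ eval f a + x * eval (deflate f a) x
eval-deflate (one ·X+ c) a x = linear a x c
  where
  linear : ∀ a x c → 1 * x + c + a * 1 ≡ 1 * a + c + x * 1
  linear = solve-∀
eval-deflate (f@(_ ·X+ _) ·X+ c) a x = begin
  eval f x * x + c + a * (q * x + eval f a)      ≡⟨ collect (eval f x) (eval f a) q a x c ⟩
  (eval f x + a * q) * x + (c + a * eval f a)    ≡⟨ cong (λ t → t * x + (c + a * eval f a)) (eval-deflate f a x) ⟩
  (eval f a + x * q) * x + (c + a * eval f a)    ≡⟨ distribute (eval f a) q a x c ⟩
  eval f a * a + c + x * (q * x + eval f a)      ∎
  where
  open ≡-Reasoning
  q = eval (deflate f a) x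
  collect : ∀ fx fa q a x c → fx * x + c + a * (q * x + fa) ≡ (fx + a * q) * x + (c + a * fa)
  collect = solve-∀
  distribute : ∀ fa q a x c → (fa + x * q) * x + (c + a * fa) ≡ fa * a + c + x * (q * x + fa)
  distribute = solve-∀

-- Lagrange's bound. For roots a and x, `eval-deflate` gives a q(x) ≡ x q(x) with q the quotient by
-- X - a. If q(x) were nonzero modulo p it would cancel, so every root other than a is a root of q,
-- whose degree is one less.
length-roots≤degree : ∀ {p n} → Prime p → (f : Monic n) {xs : List ℕ} → Unique xs →
  (∀ {x} → x ∈ xs → x < p × p ∣ eval f x) → length xs ≤ n
length-roots≤degree pr f [] roots = z≤n
length-roots≤degree pr one (_ ∷ _) roots = ⊥-elim (prime∤1 pr (proj₂ (roots (here refl))))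
length-roots≤degree {p} pr f@(_ ·X+ _) {a ∷ xs} (a∉xs ∷ u) roots =
  s≤s (length-roots≤degree pr (deflate f a) u roots′)
  where
  roots′ : ∀ {x} → x ∈ xs → x < p × p ∣ eval (deflate f a) x
  roots′ {x} x∈ with p ∣? eval (deflate f a) x
  ... | yes d = proj₁ (roots (there x∈)) , d
  ... | no p∤q = ⊥-elim (All.lookup a∉xs x∈ (≈⇒≡ (proj₁ (roots (here refl))) (proj₁ (roots (there x∈)))
    (prime-cancel pr p∤q (begin
      q * a             ≡⟨ *-comm q a ⟩
      a * q             ≈⟨ +-≈ (∣⇒≈0 (proj₂ (roots (there x∈)))) ≈-refl ⟨
      eval f x + a * q  ≡⟨ eval-deflate f a x ⟩
      eval f a + x * q  ≈⟨ +-≈ (∣⇒≈0 (proj₂ (roots (here refl)))) ≈-refl ⟩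
      x * q             ≡⟨ *-comm x q ⟩
      q * x             ∎))))
    where
    open ≈-Reasoning p
    q = eval (deflate f a) x

X^ : ∀ d → Monic d
X^ zero    = one
X^ (suc d) = X^ d ·X+ 0

eval-X^ : ∀ d x → eval (X^ d) x ≡ x ^ d
eval-X^ zero    x = refl
eval-X^ (suc d) x = trans (+-identityʳ _) (trans (cong (_* x) (eval-X^ d x)) (*-comm (x ^ d) x))

length-unity-roots : ∀ {p} → Prime p → ∀ d .{{_ : NonZero d}} {xs} → Unique xs →
  (∀ {x} → x ∈ xs → x < p × x ^ d ≈ 1 mod p) → length xs ≤ d
-- The constant term p - 1 stands for -1, so the polynomial is X^(d+1) - 1 modulo p.
length-unity-roots {p} pr (suc d) {xs} u roots = length-roots≤degree pr (X^ d ·X+ (p ∸ 1)) u roots′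
  where
  open ≈-Reasoning p
  roots′ : ∀ {x} → x ∈ xs → x < p × p ∣ eval (X^ d) x * x + (p ∸ 1)
  roots′ {x} x∈ = proj₁ (roots x∈) , ≈0⇒∣ (begin
    eval (X^ d) x * x + (p ∸ 1)  ≡⟨ cong (λ t → t * x + (p ∸ 1)) (eval-X^ d x) ⟩
    x ^ d * x + (p ∸ 1)          ≡⟨ cong (_+ (p ∸ 1)) (*-comm (x ^ d) x) ⟩
    x ^ suc d + (p ∸ 1)          ≈⟨ +-≈ (proj₂ (roots x∈)) ≈-refl ⟩
    1 + (p ∸ 1)                  ≡⟨ m+[n∸m]≡n (>-nonZero⁻¹ p {{prime⇒nonZero pr}}) ⟩
    p                            ≈⟨ ≈-self ⟩
    0                            ∎)

prime∤product : ∀ {p xs} → Prime p → (∀ {x} → x ∈ xs → ¬ (p ∣ x)) → ¬ (p ∣ product xs)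
prime∤product {xs = []}     pr p∤ d = prime∤1 pr d
prime∤product {xs = x ∷ xs} pr p∤ d =
  [ p∤ (here refl) , prime∤product pr (p∤ ∘ there) ]′ (euclidsLemma x _ pr d)

range⇒∤ : ∀ {p x} → InRange p x → ¬ (p ∣ x)
range⇒∤ (1≤x , x<p) p∣x = <⇒≱ x<p (∣⇒≤ {{>-nonZero 1≤x}} p∣x)

∤⇒range : ∀ {p x} .{{_ : NonZero p}} → ¬ (p ∣ x) → InRange p (x % p)
∤⇒range {p} {x} p∤x = n≢0⇒n>0 (λ e → p∤x (m%n≡0⇒n∣m x p e)) , m%n<n x p

prime∤product-range : ∀ {p} → Prime p → ¬ (p ∣ product (range p))
prime∤product-range pr = prime∤product pr (range⇒∤ ∘ ∈-range⁻)

-- Multiplication by x permutes the nonzero residues, so their product W satisfies x^(p-1) W ≡ W,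
-- and W cancels.
fermat : ∀ {p x} → Prime p → ¬ (p ∣ x) → x ^ (p ∸ 1) ≈ 1 mod p
fermat {p} {x} pr p∤x = prime-cancel pr (prime∤product-range pr) (begin
  W * x ^ (p ∸ 1)                            ≡⟨ *-comm W _ ⟩
  x ^ (p ∸ 1) * W                            ≡⟨ cong (λ l → x ^ l * W) (length-range p) ⟨
  x ^ length (range p) * W                   ≡⟨ cong (_* W) (product-map-const (range p) x) ⟨
  product (map (λ _ → x) (range p)) * W      ≡⟨ cong (λ l → product (map (λ _ → x) (range p)) * product l) (map-id (range p)) ⟨
  product (map (λ _ → x) (range p)) * product (map (λ i → i) (range p)) ≡⟨ product-map-* (range p) (λ _ → x) (λ i → i) ⟨
  product (map (λ i → x * i) (range p))      ≈⟨ product-map-≈ (range p) (λ _ → ≈-sym (%-≈ _ p)) ⟩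
  product (map (λ i → x * i % p) (range p))  ≡⟨ product-map-↭ (range-unique p) maps inj ⟩
  W                                          ≡⟨ *-identityʳ W ⟨
  W * 1                                      ∎)
  where
  open ≈-Reasoning p
  instance _ = prime⇒nonZero pr
  W = product (range p)
  maps : ∀ {i} → i ∈ range p → x * i % p ∈ range p
  maps i∈ = ∈-range⁺ (∤⇒range λ d → [ p∤x , range⇒∤ (∈-range⁻ i∈) ]′ (euclidsLemma x _ pr d))
  inj : InjectiveOn (range p) (λ i → x * i % p)
  inj i∈ j∈ e = ≈⇒≡ (proj₂ (∈-range⁻ i∈)) (proj₂ (∈-range⁻ j∈)) (prime-cancel pr p∤x (%⇒≈ e))

-- X^d - 1 has at most d roots, too few to contain all p - 1 nonzero residues.
∃-nonroot : ∀ {p} → Prime p → ∀ d .{{_ : NonZero d}} → d < p ∸ 1 →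
  ∃[ y ] (InRange p y × ¬ (y ^ d ≈ 1 mod p))
∃-nonroot {p} pr d d<p-1 with All.all? (λ y → y ^ d ≈? 1 mod p) (range p)
  where instance _ = prime⇒nonZero pr
... | yes all = ⊥-elim (<⇒≱ d<p-1 (subst (_≤ d) (length-range p)
  (length-unity-roots pr d (range-unique p) λ x∈ → proj₂ (∈-range⁻ x∈) , All.lookup all x∈)))
... | no ¬all with find (All.¬All⇒Any¬ (λ y → y ^ d ≈? 1 mod p) _ ¬all)
  where instance _ = prime⇒nonZero pr
... | y , y∈ , ne = y , ∈-range⁻ y∈ , ne

record HasOrder (p g d : ℕ) : Set where
  field
    order≢0 : NonZero d
    unity : g ^ d ≈ 1 mod p
    least : ∀ k → g ^ k ≈ 1 mod p → d ∣ k

open HasOrder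

^≈1⇒∤ : ∀ {p g} → Prime p → ∀ d .{{_ : NonZero d}} → g ^ d ≈ 1 mod p → ¬ (p ∣ g)
^≈1⇒∤ {p} {g} pr (suc d) e p∣g = prime∤1 pr (∣-resp-≈ e (∣m⇒∣m*n (g ^ d) p∣g))

1^≈ : ∀ {n g} → g ≈ 1 mod n → ∀ k → g ^ k ≈ 1 mod n
1^≈ e k = ≈-trans (^-≈ k e) (≈-reflexive (^-zeroˡ k))

^*-≈1 : ∀ {n} g d → g ^ d ≈ 1 mod n → ∀ k → g ^ (k * d) ≈ 1 mod n
^*-≈1 g d e k = ≈-trans (≈-reflexive (trans (cong (g ^_) (*-comm k d)) (sym (^-*-assoc g d k)))) (1^≈ e k)

^-cong-exponent : ∀ {p g d} → g ^ d ≈ 1 mod p → ∀ {a b} → a ≈ b mod d → g ^ a ≈ g ^ b mod p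
^-cong-exponent {p} {g} {d} e {a} {b} (balance k l eq) = begin
  g ^ a                ≈⟨ absorb a k ⟨
  g ^ (a + k * d)      ≡⟨ cong (g ^_) eq ⟩
  g ^ (b + l * d)      ≈⟨ absorb b l ⟩
  g ^ b                ∎
  where
  open ≈-Reasoning p
  absorb : ∀ a k → g ^ (a + k * d) ≈ g ^ a mod p
  absorb a k = begin
    g ^ (a + k * d)      ≡⟨ ^-distribˡ-+-* g a (k * d) ⟩
    g ^ a * g ^ (k * d)  ≈⟨ *-≈ˡ (g ^ a) (^*-≈1 g d e k) ⟩
    g ^ a * 1            ≡⟨ *-identityʳ _ ⟩
    g ^ a                ∎

^-injective : ∀ {p g d} → Prime p → HasOrder p g d → ∀ a b → g ^ a ≈ g ^ b mod p → a ≈ b mod d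
^-injective {p} {g} {d} pr o = wlog-+ _ (λ f e → ≈-sym (f (≈-sym e))) λ a x e →
  ∣⇒≈+ a (least o x (≈-sym (prime-cancel pr (prime∤^ pr (^≈1⇒∤ pr d {{order≢0 o}} (unity o)) a)
    (≈-trans (≈-reflexive (*-identityʳ (g ^ a))) (≈-trans e (≈-reflexive (^-distribˡ-+-* g a x)))))))

-- The powers g^0, ..., g^(d-1) are d distinct roots of X^d - 1, which has no more than d. This
-- supplies discrete logarithms to base g.
roots-are-powers : ∀ {p g d} → Prime p → HasOrder p g d → ∀ x → x ^ d ≈ 1 mod p → ∃[ i ] (i < d × x ≈ g ^ i mod p)
roots-are-powers {p} {g} {d} pr o x x^d≈1 =
  conclude (injective⇒surjective {xs = upTo d} {ys = roots} {f = power} (Unique.upTo⁺ d) maps inj bound x∈)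
  where
  instance _ = prime⇒nonZero pr
  power : ℕ → ℕ
  power i = g ^ i % p
  root? : ∀ y → Dec (y ^ d ≈ 1 mod p)
  root? y = y ^ d ≈? 1 mod p
  roots : List ℕ
  roots = filter root? (upTo p)
  intro : ∀ y → y ^ d ≈ 1 mod p → y % p ∈ roots
  intro y e = ∈-filter⁺ root? (∈-upTo⁺ (m%n<n y p)) (≈-trans (^-≈ d (%-≈ y p)) e)
  elim : ∀ {y} → y ∈ roots → y < p × y ^ d ≈ 1 mod p
  elim y∈ with ∈-filter⁻ root? {xs = upTo p} y∈
  ... | y∈upTo , e = ∈-upTo⁻ y∈upTo , e
  maps : ∀ {i} → i ∈ upTo d → power i ∈ roots
  maps {i} _ = intro (g ^ i) (≈-trans (≈-reflexive (^-*-assoc g i d)) (^*-≈1 g d (unity o) i))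
  inj : InjectiveOn (upTo d) power
  inj {i} {j} i∈ j∈ e = ≈⇒≡ (∈-upTo⁻ i∈) (∈-upTo⁻ j∈) (^-injective pr o i j (%⇒≈ e))
  bound : length roots ≤ length (upTo d)
  bound = subst (length roots ≤_) (sym (length-upTo d))
    (length-unity-roots pr d {{order≢0 o}} (Unique.filter⁺ root? {xs = upTo p} (Unique.upTo⁺ p)) elim)
  x∈ : x % p ∈ roots
  x∈ = intro x x^d≈1
  conclude : ∃[ i ] (i ∈ upTo d × x % p ≡ power i) → ∃[ i ] (i < d × x ≈ g ^ i mod p)
  conclude (i , i∈ , e) = i , ∈-upTo⁻ i∈ , %⇒≈ e

-- If q ∤ k and z^k ≡ 1, Bézout gives multiples of q and of k that differ by 1. Both are exponents
-- that send z to 1, so z ≡ 1.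
prime-order : ∀ {p q z} → Prime q → z ^ q ≈ 1 mod p → ¬ (z ≈ 1 mod p) → HasOrder p z q
prime-order {p} {q} {z} pr e z≉1 = record { order≢0 = prime⇒nonZero pr ; unity = e ; least = λ k e′ → decide k e′ (q ∣? k) }
  where
  z^[1+a]≈1 : ∀ a b → 1 + a ≡ b → z ^ a ≈ 1 mod p → z ^ b ≈ 1 mod p → z ≈ 1 mod p
  z^[1+a]≈1 a .(1 + a) refl ea eb = begin
    z          ≡⟨ *-identityʳ z ⟨
    z * 1      ≈⟨ *-≈ˡ z ea ⟨
    z * z ^ a  ≈⟨ eb ⟩
    1          ∎
    where open ≈-Reasoning p
  decide : ∀ k → z ^ k ≈ 1 mod p → Dec (q ∣ k) → q ∣ k
  decide k e′ (yes q∣k) = q∣k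
  decide k e′ (no q∤k) with coprime-Bézout (prime∤⇒coprime pr q∤k)
  ... | Bézout.+- x y eq = ⊥-elim (z≉1 (z^[1+a]≈1 (y * k) (x * q) eq (^*-≈1 z k e′ y) (^*-≈1 z q e x)))
  ... | Bézout.-+ x y eq = ⊥-elim (z≉1 (z^[1+a]≈1 (x * q) (y * k) eq (^*-≈1 z q e x) (^*-≈1 z k e′ y)))

-- With p - 1 = Dq, the element y^D works for any y that is not a root of X^D - 1.
∃-prime-order : ∀ {p q} → Prime p → Prime q → q ∣ p ∸ 1 → ∃[ z ] HasOrder p z q
∃-prime-order {p} {q} pr prq (divides D p-1≡Dq) with ∃-nonroot pr D {{D≢0}} D<p-1
  where
  D≢0 : NonZero D
  D≢0 = ≢-nonZero λ { refl → <⇒≢ (m<n⇒0<n∸m (prime>1 pr)) (sym p-1≡Dq) }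
  D<p-1 : D < p ∸ 1
  D<p-1 = subst (D <_) (sym p-1≡Dq) (m<m*n D q {{D≢0}} (prime>1 prq))
... | y , y∈ , ne = y ^ D , prime-order prq
  (≈-trans (≈-reflexive (trans (^-*-assoc y D q) (cong (y ^_) (sym p-1≡Dq)))) (fermat pr (range⇒∤ y∈))) ne

^-distribʳ-* : ∀ k m n → (m * n) ^ k ≡ m ^ k * n ^ k
^-distribʳ-* zero    m n = refl
^-distribʳ-* (suc k) m n = trans (cong (m * n *_) (^-distribʳ-* k m n)) ([m*n]*[o*p]≡[m*o]*[n*p] m n (m ^ k) (n ^ k))

-- If (gh)^k ≡ 1, raising to the power d removes h and leaves g^(dk) ≡ 1, so c ∣ dk and by
-- coprimality c ∣ k. The argument for d is symmetric.
*-order : ∀ {p g h c d} → HasOrder p g c → HasOrder p h d → Coprime c d → HasOrder p (g * h) (c * d)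
*-order {p} {g} {h} {c} {d} og oh cop = record
  { order≢0 = m*n≢0 c d {{order≢0 og}} {{order≢0 oh}}
  ; unity   = ≈-trans (≈-reflexive (^-distribʳ-* (c * d) g h)) (*-≈
      (≈-trans (≈-reflexive (cong (g ^_) (*-comm c d))) (^*-≈1 g c (unity og) d)) (^*-≈1 h d (unity oh) c))
  ; least   = λ k e → coprime-*-∣ cop
      (coprime-divisor cop (least og (d * k) (part g h d (unity oh) k e)))
      (coprime-divisor (λ (a , b) → cop (b , a)) (least oh (c * k) (part h g c (unity og) k
        (≈-trans (≈-reflexive (cong (_^ k) (*-comm h g))) e))))
  }
  where
  part : ∀ g h d → h ^ d ≈ 1 mod p → ∀ k → (g * h) ^ k ≈ 1 mod p → g ^ (d * k) ≈ 1 mod p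
  part g h d e k e′ = begin
    g ^ (d * k)                ≡⟨ *-identityʳ _ ⟨
    g ^ (d * k) * 1            ≈⟨ *-≈ˡ (g ^ (d * k)) (≈-trans (≈-reflexive (cong (h ^_) (*-comm d k))) (^*-≈1 h d e k)) ⟨
    g ^ (d * k) * h ^ (d * k)  ≡⟨ ^-distribʳ-* (d * k) g h ⟨
    (g * h) ^ (d * k)          ≈⟨ ^*-≈1 (g * h) k e′ d ⟩
    1                          ∎
    where open ≈-Reasoning p

-- Residues modulo an odd prime

swap : ℕ → ℕ → ℕ → ℕ
swap i j k with k ≟ i | k ≟ j
... | yes _ | _     = j
... | no _  | yes _ = i
... | no _  | no _  = k

swap-left : ∀ i j → swap i j i ≡ j
swap-left i j with i ≟ i
... | yes _  = refl
... | no i≢i = ⊥-elim (i≢i refl)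

swap-right : ∀ i j → swap i j j ≡ i
swap-right i j with j ≟ i | j ≟ j
... | yes j≡i | _      = j≡i
... | no _    | yes _  = refl
... | no _    | no j≢j = ⊥-elim (j≢j refl)

swap-other : ∀ {i j k} → k ≢ i → k ≢ j → swap i j k ≡ k
swap-other {i} {j} {k} k≢i k≢j with k ≟ i | k ≟ j
... | yes k≡i | _       = ⊥-elim (k≢i k≡i)
... | no _    | yes k≡j = ⊥-elim (k≢j k≡j)
... | no _    | no _    = refl

swap-involutive : ∀ i j k → swap i j (swap i j k) ≡ k
swap-involutive i j k with k ≟ i | k ≟ j
... | yes refl | _        = swap-right i j
... | no _     | yes refl = swap-left i j
... | no k≢i   | no k≢j   = swap-other k≢i k≢j

swap-injective : ∀ i j {k l} → swap i j k ≡ swap i j l → k ≡ l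
swap-injective i j {k} {l} e = trans (sym (swap-involutive i j k)) (trans (cong (swap i j) e) (swap-involutive i j l))

swap-preserves : (P : ℕ → Set) → ∀ {i j k} → P i → P j → P k → P (swap i j k)
swap-preserves P {i} {j} {k} Pi Pj Pk with k ≟ i | k ≟ j
... | yes _ | _     = Pj
... | no _  | yes _ = Pi
... | no _  | no _  = Pk

-- A permutation (a , e) ↦ (exponent a e mod m , tag a e) of ℤ/m × {0, 1} such that, for each e,
-- the map a ↦ a · exponent a e permutes ℤ/m; injectivity suffices as the sets are finite.
record ExponentSystem (m : ℕ) : Set where
  field
    exponent : ℕ → Bool → ℕ
    tag      : ℕ → Bool → Bool
    tagged-injective : ∀ {a b e e′} → a < m → b < m →
      exponent a e ≈ exponent b e′ mod m → tag a e ≡ tag b e′ → a ≡ b × e ≡ e′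
    product-injective : ∀ {a b} e → a < m → b < m →
      a * exponent a e ≈ b * exponent b e mod m → a ≡ b

*-exchangeˡ : ∀ a b c → a * (b * c) ≡ b * (a * c)
*-exchangeˡ = solve-∀

xor-cancelˡ : ∀ x {y z} → x xor y ≡ x xor z → y ≡ z
xor-cancelˡ false e = e
xor-cancelˡ true {false} {false} e = refl
xor-cancelˡ true {true}  {true}  e = refl

-- Writing the prime as q = 2 + r makes r = q - 2 the exponent that inverts nonzero residues, while
-- `last` = 1 + r represents -1.
module OddPrime (r : ℕ) (r≢0 : NonZero r) (prime : Prime (2 + r)) where

  open ≈-Reasoning (2 + r)

  private
    q = 2 + r
    last = 1 + r

    last²≈1 : last * last ≈ 1 mod q
    last²≈1 = ≈-trans (≈-reflexive (square r)) (≈-sym (∣⇒≈+ 1 (n∣m*n r)))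
      where
      square : ∀ r → (1 + r) * (1 + r) ≡ 1 + r * (2 + r)
      square = solve-∀

    q∤last : ¬ (q ∣ last)
    q∤last = range⇒∤ (s≤s z≤n , ≤-refl)

    1<q : 1 < q
    1<q = s≤s (s≤s z≤n)

  data View : ℕ → Set where
    isZero : View 0
    isLast : View (1 + r)
    isMid  : ∀ {a} → a ≢ 0 → a ≢ last → 1 + a < q → View a

  view : ∀ {a} → a < q → View a
  view {a} a<q with a ≟ 0 | a ≟ last
  ... | yes refl | _        = isZero
  ... | no _     | yes refl = isLast
  ... | no a≢0   | no a≢l   = isMid a≢0 a≢l (s≤s (≤∧≢⇒< (s≤s⁻¹ a<q) a≢l))

  mid⇒∤ : ∀ {a} → a ≢ 0 → 1 + a < q → ¬ (q ∣ a)
  mid⇒∤ a≢0 a<q = range⇒∤ (n≢0⇒n>0 a≢0 , <-trans ≤-refl a<q)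

  -- x ^ r is the inverse of x modulo 2 + r, by Fermat.
  inverse-injective : ∀ {x y} → x < q → y < q → x ^ r ≈ y ^ r mod q → x ≡ y
  inverse-injective {x} {y} x<q y<q e with q ∣? x | q ∣? y
  ... | yes q∣x | yes q∣y = ≈⇒≡ x<q y<q (≈-trans (∣⇒≈0 q∣x) (≈-sym (∣⇒≈0 q∣y)))
  ... | yes q∣x | no q∤y = ⊥-elim (prime∤^ prime q∤y r (∣-resp-≈ e (∣-^ r (>-nonZero⁻¹ r {{r≢0}}) q∣x)))
  ... | no q∤x | yes q∣y = ⊥-elim (prime∤^ prime q∤x r (∣-resp-≈ (≈-sym e) (∣-^ r (>-nonZero⁻¹ r {{r≢0}}) q∣y)))
  ... | no q∤x | no q∤y = ≈⇒≡ x<q y<q (begin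
    x                ≡⟨ *-identityʳ x ⟨
    x * 1            ≈⟨ *-≈ˡ x (fermat prime q∤y) ⟨
    x * (y * y ^ r)  ≈⟨ *-≈ˡ x (*-≈ˡ y e) ⟨
    x * (y * x ^ r)  ≡⟨ *-exchangeˡ x y (x ^ r) ⟩
    y * (x * x ^ r)  ≈⟨ *-≈ˡ y (fermat prime q∤x) ⟩
    y * 1            ≡⟨ *-identityʳ y ⟩
    y                ∎)

  -- c(a) = 1 + 1/a, except c(0) = 0 and c(−1) = 1.
  c : ℕ → ℕ
  c a = 1 + swap 0 last a ^ r

  c-injective : ∀ {a b} → a < q → b < q → c a ≈ c b mod q → a ≡ b
  c-injective a<q b<q e = swap-injective 0 last
    (inverse-injective (swap-preserves (_< q) (s≤s z≤n) ≤-refl a<q) (swap-preserves (_< q) (s≤s z≤n) ≤-refl b<q) (+-cancelˡ-≈ 1 e))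

  last*c : last * c last ≈ last mod q
  last*c = ≈-reflexive (trans (cong (λ t → last * (1 + t ^ r)) (swap-right 0 last))
    (trans (cong (λ t → last * (1 + t)) (0^ r r≢0)) (*-identityʳ last)))
    where
    0^ : ∀ r → NonZero r → 0 ^ r ≡ 0
    0^ (suc r) _ = refl

  mid*c : ∀ {a} → a ≢ 0 → a ≢ last → 1 + a < q → a * c a ≈ 1 + a mod q
  mid*c {a} a≢0 a≢l a<q = begin
    a * (1 + swap 0 last a ^ r)  ≡⟨ cong (λ t → a * (1 + t ^ r)) (swap-other a≢0 a≢l) ⟩
    a * (1 + a ^ r)              ≡⟨ *-distribˡ-+ a 1 (a ^ r) ⟩
    a * 1 + a * a ^ r            ≈⟨ +-≈ (≈-reflexive (*-identityʳ a)) (fermat prime (mid⇒∤ a≢0 a<q)) ⟩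
    a + 1                        ≡⟨ +-comm a 1 ⟩
    1 + a                        ∎

  private
    W = product (range q)

    -- The product a c(a) is 1 + a for a ≠ -1 and -1 at a = -1. On 1, ..., `last` the minimum
    -- expresses both cases at once.
    times-c : ℕ → ℕ
    times-c a = (1 + a) ⊓ last

    *c≈ : ∀ {a} → a ∈ range q → a * c a ≈ times-c a mod q
    *c≈ a∈ with ∈-range⁻ a∈
    ... | 0<a , a<q with view a<q
    ... | isLast = ≈-trans last*c (≈-reflexive (sym (m≥n⇒m⊓n≡n (n≤1+n last))))
    ... | isMid a≢0 a≢l a<l = ≈-trans (mid*c a≢0 a≢l a<l) (≈-reflexive (sym (m≤n⇒m⊓n≡m (s≤s⁻¹ a<l))))

    q∤c : ∀ {a} → a ∈ range q → ¬ (q ∣ c a)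
    q∤c {a} a∈ d = range⇒∤ (s≤s z≤n , s≤s (m⊓n≤n (1 + a) last))
      (∣-resp-≈ (*c≈ a∈) (∣n⇒∣m*n a d))

    -- The values are 2, 3, ..., `last` and then `last` once more; a factor 1 completes the first
    -- run to W.
    product-times-c : product (map times-c (range q)) ≈ W * last mod q
    product-times-c = begin
      product (map times-c (range q))                     ≡⟨ cong (product ∘ map times-c) (applyUpTo-∷ʳ suc r) ⟨
      product (map times-c (xs ∷ʳ last))                  ≡⟨ cong product (map-++ times-c xs [ last ]) ⟩
      product (map times-c xs ∷ʳ times-c last)            ≡⟨ product-++ (map times-c xs) [ times-c last ] ⟩
      product (map times-c xs) * (times-c last * 1)       ≡⟨ cong (product (map times-c xs) *_) (trans (*-identityʳ _) (m≥n⇒m⊓n≡n (n≤1+n last))) ⟩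
      product (map times-c xs) * last                     ≈⟨ *-≈ (product-map-≈ xs bounded) (≈-refl {a = last}) ⟩
      product (map suc xs) * last                         ≡⟨ cong (λ l → product l * last) (map-applyUpTo suc suc r) ⟩
      product (applyUpTo (suc ∘ suc) r) * last            ≡⟨ cong (_* last) (*-identityˡ (product (applyUpTo (suc ∘ suc) r))) ⟨
      W * last                                            ∎
      where
      xs = applyUpTo suc r
      bounded : ∀ {a} → a ∈ xs → times-c a ≈ suc a mod q
      bounded a∈ with ∈-applyUpTo⁻ suc a∈
      ... | i , i<r , refl = ≈-reflexive (m≤n⇒m⊓n≡m (s≤s i<r))

    product-map-id : (xs : List ℕ) → product (map (λ x → x) xs) ≡ product xs
    product-map-id xs = cong product (map-id xs)

  -- Modulo q the map `f` permutes the nonzero residues, so the factors a and the factors f(a) each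
  -- contribute W.
  product-twisted : (f : ℕ → ℕ) → (∀ {a} → a ∈ range q → ¬ (q ∣ f a)) →
    (∀ {a b} → a ∈ range q → b ∈ range q → f a ≈ f b mod q → a ≡ b) →
    product (map (λ a → a * f a) (range q)) ≈ W * W mod q
  product-twisted f q∤f inj = begin
    product (map (λ a → a * f a) (range q))                          ≡⟨ product-map-* (range q) (λ a → a) f ⟩
    product (map (λ a → a) (range q)) * product (map f (range q))    ≡⟨ cong (_* product (map f (range q))) (product-map-id (range q)) ⟩
    W * product (map f (range q))                                    ≈⟨ *-≈ˡ W (product-map-≈ (range q) λ {a} _ → %-≈ (f a) q) ⟨
    W * product (map (λ a → f a % q) (range q))                      ≡⟨ cong (W *_) (product-map-↭ (range-unique q)
                                                                          (λ a∈ → ∈-range⁺ (∤⇒range (q∤f a∈)))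
                                                                          (λ a∈ b∈ e → inj a∈ b∈ (%⇒≈ e))) ⟩
    W * W                                                            ∎

  -- The product of all a c(a) is evaluated twice: as W² because c permutes the nonzero residues,
  -- and as W · (-1) from the explicit values.
  wilson : W ≈ last mod q
  wilson = prime-cancel prime (prime∤product-range prime) (begin
    W * W                                     ≈⟨ product-twisted c q∤c (λ a∈ b∈ → c-injective (proj₂ (∈-range⁻ a∈)) (proj₂ (∈-range⁻ b∈))) ⟨
    product (map (λ a → a * c a) (range q))   ≈⟨ product-map-≈ (range q) *c≈ ⟩
    product (map times-c (range q))           ≈⟨ product-times-c ⟩
    W * last                                  ∎)

  -- Once κ(0) = 0, both κ and i ↦ i κ(i) permute the nonzero residues. The product of all i κ(i) is
  -- then both W² and W, so W ≡ 1, while Wilson's theorem gives W ≡ -1, and q > 2.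
  no-multiplicative-complete-mapping : (κ : ℕ → ℕ) → (∀ {i} → i < q → κ i < q) →
    (∀ {i j} → i < q → j < q → κ i ≡ κ j → i ≡ j) →
    (∀ {i j} → i < q → j < q → i * κ i ≈ j * κ j mod q → i ≡ j) → ⊥
  no-multiplicative-complete-mapping κ κ< κ-inj iκ-inj with
    injective⇒surjective {xs = upTo q} {f = κ} (Unique.upTo⁺ q) (λ i∈ → ∈-upTo⁺ (κ< (∈-upTo⁻ i∈)))
      (λ i∈ j∈ → κ-inj (∈-upTo⁻ i∈) (∈-upTo⁻ j∈)) ≤-refl (∈-upTo⁺ {q} {0} z<s)
  ... | i , i∈ , 0≡κi = ≢-nonZero⁻¹ r {{r≢0}} (suc-injective (sym (≈⇒≡ 1<q ≤-refl 1≈last)))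
    where
    -- The i with κ(i) = 0 gives i κ(i) = 0 = 0 κ(0), so injectivity of the products forces i = 0.
    κ0≡0 : κ 0 ≡ 0
    κ0≡0 = trans (cong κ (sym (iκ-inj (∈-upTo⁻ i∈) z<s (≈-reflexive (trans (cong (i *_) (sym 0≡κi)) (*-zeroʳ i)))))) (sym 0≡κi)
    κ∤ : ∀ {i} → i ∈ range q → ¬ (q ∣ κ i)
    κ∤ {i} i∈ d with ∈-range⁻ i∈
    ... | 0<i , i<q = <⇒≢ 0<i (sym (κ-inj i<q z<s (trans (≈⇒≡ (κ< i<q) z<s (∣⇒≈0 d)) (sym κ0≡0))))
    iκ∤ : ∀ {i} → i ∈ range q → ¬ (q ∣ i * κ i)
    iκ∤ {i} i∈ d = [ range⇒∤ (∈-range⁻ i∈) , κ∤ i∈ ]′ (euclidsLemma i (κ i) prime d)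
    1≈last : 1 ≈ last mod q
    1≈last = ≈-trans (prime-cancel prime (prime∤product-range prime) (begin
      W * 1                                        ≡⟨ *-identityʳ W ⟩
      W                                            ≡⟨ product-map-↭ (range-unique q) (λ i∈ → ∈-range⁺ (∤⇒range (iκ∤ i∈)))
                                                        (λ i∈ j∈ e → iκ-inj (proj₂ (∈-range⁻ i∈)) (proj₂ (∈-range⁻ j∈)) (%⇒≈ e)) ⟨
      product (map (λ i → i * κ i % q) (range q))  ≈⟨ product-map-≈ (range q) (λ {i} _ → %-≈ (i * κ i) q) ⟩
      product (map (λ i → i * κ i) (range q))      ≈⟨ product-twisted κ κ∤ (λ i∈ j∈ e → κ-inj (proj₂ (∈-range⁻ i∈)) (proj₂ (∈-range⁻ j∈))
                                                        (≈⇒≡ (κ< (proj₂ (∈-range⁻ i∈))) (κ< (proj₂ (∈-range⁻ j∈))) e)) ⟩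
      W * W                                        ∎)) wilson

  private
    sign : Bool → ℕ
    sign false = 1
    sign true  = last

    q∤sign : ∀ e → ¬ (q ∣ sign e)
    q∤sign false = prime∤1 prime
    q∤sign true  = q∤last

    sign-not : ∀ e → sign (not e) * last ≈ sign e mod q
    sign-not false = last²≈1
    sign-not true  = ≈-reflexive (*-identityˡ last)

    isLast? : ℕ → Bool
    isLast? a = does (a ≟ last)

    isLast?-last : isLast? last ≡ true
    isLast?-last = dec-true (last ≟ last) refl

    isLast?-other : ∀ {a} → a ≢ last → isLast? a ≡ false
    isLast?-other {a} = dec-false (a ≟ last)

    -- Translation by 1 followed by the transposition of 0 and 1: it fixes 0, sends -1 to 1 and
    -- every other a to 1 + a. Up to sign these are the products a · exponent.
    π : ℕ → ℕ
    π a = swap 0 1 ((1 + a) % q)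

    π-injective : ∀ {a b} → a < q → b < q → π a ≈ π b mod q → a ≡ b
    π-injective {a} {b} a<q b<q e = ≈⇒≡ a<q b<q (+-cancelˡ-≈ 1 (%⇒≈
      (swap-injective 0 1 (≈⇒≡ (swap-preserves (_< q) z<s 1<q (m%n<n (1 + a) q)) (swap-preserves (_< q) z<s 1<q (m%n<n (1 + b) q)) e))))

    π-zero : π 0 ≡ 0
    π-zero = trans (cong (swap 0 1) (m<n⇒m%n≡m 1<q)) (swap-right 0 1)

    π-last : π last ≡ 1
    π-last = trans (cong (swap 0 1) (n%n≡0 q)) (swap-left 0 1)

    π-mid : ∀ {a} → a ≢ 0 → 1 + a < q → π a ≡ 1 + a
    π-mid a≢0 a<q = trans (cong (swap 0 1) (m<n⇒m%n≡m a<q)) (swap-other {0} {1} (λ ()) (a≢0 ∘ suc-injective))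

  -- For a other than 0 and -1 the products are `sign e` times 2, ..., q - 1, which misses 0 and
  -- `sign e`. The point 0 supplies 0. At -1 the sign is flipped, so that -1 times -`sign e`
  -- supplies the other. The tag records the sign used, so exponent and tag determine c(a), then a
  -- and e.
  oddPrimeSystem : ExponentSystem q
  oddPrimeSystem = record
    { exponent          = exponent
    ; tag               = tag
    ; tagged-injective  = tagged
    ; product-injective = λ {a} {b} e a<q b<q eq → π-injective a<q b<q (prime-cancel prime (q∤sign e)
        (≈-trans (≈-sym (product≈ e (view a<q))) (≈-trans eq (product≈ e (view b<q)))))
    }
    where
    tag : ℕ → Bool → Bool
    tag a e = isLast? a xor e
    exponent : ℕ → Bool → ℕ
    exponent a e = sign (tag a e) * c a
    tagged : ∀ {a b e e′} → a < q → b < q → exponent a e ≈ exponent b e′ mod q → tag a e ≡ tag b e′ → a ≡ b × e ≡ e′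
    tagged {a} {b} {e} {e′} a<q b<q eq teq = a≡b , xor-cancelˡ (isLast? a) (trans teq (cong (λ t → isLast? t xor e′) (sym a≡b)))
      where
      a≡b : a ≡ b
      a≡b = c-injective a<q b<q
        (prime-cancel prime (q∤sign (tag b e′)) (subst (λ t → sign t * c a ≈ exponent b e′ mod q) teq eq))
    product≈ : ∀ {a} e → View a → a * exponent a e ≈ sign e * π a mod q
    product≈ e isZero = ≈-reflexive (sym (trans (cong (sign e *_) π-zero) (*-zeroʳ (sign e))))
    product≈ e isLast = begin
      last * (sign (isLast? last xor e) * c last)  ≡⟨ cong (λ t → last * (sign (t xor e) * c last)) isLast?-last ⟩
      last * (sign (not e) * c last)               ≡⟨ *-exchangeˡ last (sign (not e)) (c last) ⟩
      sign (not e) * (last * c last)               ≈⟨ *-≈ˡ (sign (not e)) last*c ⟩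
      sign (not e) * last                          ≈⟨ sign-not e ⟩
      sign e                                       ≡⟨ *-identityʳ (sign e) ⟨
      sign e * 1                                   ≡⟨ cong (sign e *_) π-last ⟨
      sign e * π last                              ∎
    product≈ e (isMid {a} a≢0 a≢l a<l) = begin
      a * (sign (isLast? a xor e) * c a)  ≡⟨ cong (λ t → a * (sign (t xor e) * c a)) (isLast?-other a≢l) ⟩
      a * (sign e * c a)                  ≡⟨ *-exchangeˡ a (sign e) (c a) ⟩
      sign e * (a * c a)                  ≈⟨ *-≈ˡ (sign e) (mid*c a≢0 a≢l a<l) ⟩
      sign e * (1 + a)                    ≡⟨ cong (sign e *_) (π-mid a≢0 a<l) ⟨
      sign e * π a                        ∎

-- Exponents for squarefree p − 1

open ExponentSystem

crt : ∀ {m n} .{{_ : NonZero m}} .{{_ : NonZero n}} → Coprime m n → ∀ x y → ∃[ z ] (z ≈ x mod m × z ≈ y mod n)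
crt {m} {n} c x y = solve (coprime-Bézout c)
  where
  combine : ∀ {m n} .{{_ : NonZero n}} u → u ≈ 0 mod m → u ≈ 1 mod n → ∀ x y → ∃[ z ] (z ≈ x mod m × z ≈ y mod n)
  -- This is x + u (y - x) with u ≡ 0 modulo m and u ≡ 1 modulo n; since n = k + 1, the term k x
  -- stands for -x.
  combine {m} {suc k} u u≈0 u≈1 x y = x + u * (y + k * x) ,
    ≈-trans (+-≈ (≈-refl {a = x}) (*-≈ u≈0 (≈-refl {a = y + k * x}))) (≈-reflexive (+-identityʳ x)) ,
    ≈-trans (+-≈ (≈-refl {a = x}) (*-≈ u≈1 (≈-refl {a = y + k * x})))
      (≈-trans (≈-reflexive (rearrange x y k)) (≈-sym (∣⇒≈+ y (n∣m*n x))))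
    where
    rearrange : ∀ x y k → x + 1 * (y + k * x) ≡ y + x * (1 + k)
    rearrange = solve-∀
  1+≈1 : ∀ {n} k l → 1 + k * n ≡ l → l ≈ 1 mod n
  1+≈1 k .(1 + k * _) refl = ≈-sym (∣⇒≈+ 1 (n∣m*n k))
  solve : Bézout.Identity 1 m n → ∃[ z ] (z ≈ x mod m × z ≈ y mod n)
  solve (Bézout.+- k l e) = combine (k * m) (∣⇒≈0 (n∣m*n k)) (1+≈1 l (k * m) e) x y
  solve (Bézout.-+ k l e) with combine (l * n) (∣⇒≈0 (n∣m*n l)) (1+≈1 k (l * n) e) y x
  ... | z , z≈y , z≈x = z , z≈x , z≈y

%≡⇒≈crt : ∀ {m n a b} .{{_ : NonZero m}} .{{_ : NonZero n}} → Coprime m n → a < m * n → b < m * n →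
  a % m ≡ b % m → a % n ≡ b % n → a ≡ b
%≡⇒≈crt c a< b< e e′ = ≈⇒≡ a< b< (≈-crt c _ _ (%⇒≈ e) (%⇒≈ e′))

-- The bit passes through the two systems in turn: `N` turns e into `tagN`, `M` takes that as its
-- own bit, and the tag of `M` is the final one. Tagged injectivity is unwound backwards: `M`
-- recovers a modulo m and `tagN`, after which `N` recovers a modulo n and e.
module _ {m n : ℕ} (m≢0 : NonZero m) (n≢0 : NonZero n) (c : Coprime m n)
         (M : ExponentSystem m) (N : ExponentSystem n) where

  private
    instance
      _ = m≢0
      _ = n≢0

    tagN : ℕ → Bool → Bool
    tagN a e = tag N (a % n) e

    expM expN : ℕ → Bool → ℕ
    expM a e = exponent M (a % m) (tagN a e)
    expN a e = exponent N (a % n) e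

    glued : ∀ a e → ∃[ z ] (z ≈ expM a e mod m × z ≈ expN a e mod n)
    glued a e = crt c (expM a e) (expN a e)

    exp : ℕ → Bool → ℕ
    exp a e = proj₁ (glued a e)

    exp≈M : ∀ a e → exp a e ≈ expM a e mod m
    exp≈M a e = proj₁ (proj₂ (glued a e))

    exp≈N : ∀ a e → exp a e ≈ expN a e mod n
    exp≈N a e = proj₂ (proj₂ (glued a e))

    tagged : ∀ {a b e e′} → a < m * n → b < m * n → exp a e ≈ exp b e′ mod (m * n) →
      tag M (a % m) (tagN a e) ≡ tag M (b % m) (tagN b e′) → a ≡ b × e ≡ e′
    tagged {a} {b} {e} {e′} a< b< eq teq = %≡⇒≈crt c a< b< (proj₁ onM) (proj₁ onN) , proj₂ onN
      where
      onM : a % m ≡ b % m × tagN a e ≡ tagN b e′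
      onM = tagged-injective M (m%n<n a m) (m%n<n b m)
        (≈-trans (≈-sym (exp≈M a e)) (≈-trans (≈-weaken (m∣m*n n) eq) (exp≈M b e′))) teq
      onN : a % n ≡ b % n × e ≡ e′
      onN = tagged-injective N (m%n<n a n) (m%n<n b n)
        (≈-trans (≈-sym (exp≈N a e)) (≈-trans (≈-weaken (n∣m*n m) eq) (exp≈N b e′))) (proj₂ onM)

    reduce : ∀ {k} .{{_ : NonZero k}} a {x y} → x ≈ y mod k → a * x ≈ a % k * y mod k
    reduce {k} a x≈y = *-≈ (≈-sym (%-≈ a k)) x≈y

    products : ∀ {a b} e → a < m * n → b < m * n → a * exp a e ≈ b * exp b e mod (m * n) → a ≡ b
    products {a} {b} e a< b< eq = %≡⇒≈crt c a< b< eqm eqn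
      where
      eqn : a % n ≡ b % n
      eqn = product-injective N e (m%n<n a n) (m%n<n b n)
        (≈-trans (≈-sym (reduce a (exp≈N a e))) (≈-trans (≈-weaken (n∣m*n m) eq) (reduce b (exp≈N b e))))
      -- Equality modulo n is obtained first because the bit given to `M` depends on a modulo n;
      -- after rewriting, both sides use the same bit.
      eqm : a % m ≡ b % m
      eqm = product-injective M (tagN a e) (m%n<n a m) (m%n<n b m)
        (≈-trans (≈-sym (reduce a (exp≈M a e))) (≈-trans (≈-weaken (m∣m*n n) eq)
          (≈-trans (reduce b (exp≈M b e)) (≈-reflexive (cong (λ t → b % m * exponent M (b % m) (tag N t e)) (sym eqn))))))

  productSystem : ExponentSystem (m * n)
  productSystem = record
    { exponent = exp ; tag = λ a e → tag M (a % m) (tagN a e)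
    ; tagged-injective = tagged ; product-injective = products }

oneSystem : ExponentSystem 1
oneSystem = record
  { exponent = λ _ _ → 0 ; tag = λ _ e → e
  ; tagged-injective  = λ { (s≤s z≤n) (s≤s z≤n) _ e → refl , e }
  ; product-injective = λ { _ (s≤s z≤n) (s≤s z≤n) _ → refl } }

twoSystem : ExponentSystem 2
twoSystem = record
  { exponent = λ a _ → a ; tag = λ _ e → e
  ; tagged-injective  = λ a< b< e t → ≈⇒≡ a< b< e , t
  ; product-injective = λ _ a< b< e → ≈⇒≡ a< b< (≈-trans (≈-reflexive (sym (idem a<))) (≈-trans e (≈-reflexive (idem b<)))) }
  where
  idem : ∀ {a} → a < 2 → a * a ≡ a
  idem {0} _ = refl
  idem {1} _ = refl
  idem {suc (suc _)} (s≤s (s≤s ()))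

primeSystem : ∀ q → Prime q → ExponentSystem q
primeSystem 0 pr = ⊥-elim (¬prime[0] pr)
primeSystem 1 pr = ⊥-elim (¬prime[1] pr)
primeSystem 2 pr = twoSystem
primeSystem (suc (suc (suc r))) pr = OddPrime.oddPrimeSystem (suc r) _ pr

coprime-product : ∀ {q qs} → Prime q → All Prime qs → All (q ≢_) qs → Coprime q (product qs)
coprime-product pr prs q∉ = prime∤⇒coprime pr λ d →
  All.lookup q∉ (factorisationHasAllPrimeFactors pr d prs) refl

squarefreeSystem : ∀ {qs} → All Prime qs → Unique qs → ExponentSystem (product qs)
squarefreeSystem [] [] = oneSystem
squarefreeSystem {q ∷ _} (pr ∷ prs) (q∉ ∷ u) = productSystem (prime⇒nonZero pr) (productOfPrimes≢0 prs)
  (coprime-product pr prs q∉) (primeSystem q pr) (squarefreeSystem prs u)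

-- Elements of the distinct prime orders are multiplied together. When the product is all of p - 1
-- this is a primitive root.
∃-squarefree-order : ∀ {p qs} → Prime p → All Prime qs → Unique qs → product qs ∣ p ∸ 1 → ∃[ g ] HasOrder p g (product qs)
∃-squarefree-order pr [] [] d = 1 , record { order≢0 = _ ; unity = ≈-refl ; least = λ k _ → 1∣ k }
∃-squarefree-order {p} {q ∷ qs} pr (prq ∷ prs) (q∉ ∷ u) d =
  proj₁ z * proj₁ g , *-order (proj₂ z) (proj₂ g) (coprime-product prq prs q∉)
  where
  z : ∃[ z ] HasOrder p z q
  z = ∃-prime-order pr prq (∣-trans (m∣m*n (product qs)) d)
  g : ∃[ g ] HasOrder p g (product qs)
  g = ∃-squarefree-order pr prs u (∣-trans (n∣m*n q) d)

-- The orthomorphism modulo 2p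

module Construction (p m g : ℕ) (prime : Prime p) (p-odd : Odd p) (p≡1+m : p ≡ 1 + m)
                    (order : HasOrder p g m) (E : ExponentSystem m) where

  private
    instance
      p≢0 = prime⇒nonZero prime
      2p≢0 = m*n≢0 2 p
      m≢0 = HasOrder.order≢0 order

    p∸1≡m : p ∸ 1 ≡ m
    p∸1≡m = cong (_∸ 1) p≡1+m

    even : ℕ → Bool
    even x = x % 2 ≡ᵇ 0

    even-≈ : ∀ {x y} → x ≈ y mod 2 → even x ≡ even y
    even-≈ e = cong (_≡ᵇ 0) (≈⇒% e)

    even-reflects : ∀ {x y} → even x ≡ even y → x ≈ y mod 2
    even-reflects {x} {y} e = %⇒≈ (bit (m%n<n x 2) (m%n<n y 2) e)
      where
      bit : ∀ {u v} → u < 2 → v < 2 → (u ≡ᵇ 0) ≡ (v ≡ᵇ 0) → u ≡ v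
      bit {0} {0} _ _ _ = refl
      bit {1} {1} _ _ _ = refl
      bit {suc (suc _)} (s≤s (s≤s ()))
      bit {0} {suc (suc _)} _ (s≤s (s≤s ()))
      bit {1} {suc (suc _)} _ (s≤s (s≤s ()))

    ^-parity : ∀ x k → 0 < k → x ^ k ≈ x mod 2
    ^-parity x (suc k) _ = cases (x % 2) (m%n<n x 2) (≈-sym (%-≈ x 2))
      where
      cases : ∀ u → u < 2 → x ≈ u mod 2 → x ^ suc k ≈ x mod 2
      cases 0 _ e = ≈-trans (^-≈ (suc k) e) (≈-sym e)
      cases 1 _ e = ≈-trans (1^≈ e (suc k)) (≈-sym e)
      cases (suc (suc _)) (s≤s (s≤s ()))

    discreteLog : ∀ {x} → ¬ (p ∣ x) → ∃[ i ] (i < m × x ≈ g ^ i mod p)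
    discreteLog {x} p∤x = roots-are-powers prime order x
      (≈-trans (≈-reflexive (cong (x ^_) (sym p∸1≡m))) (fermat prime p∤x))

    -- The exponent in {1, …, m} congruent to b modulo m, moved to {m + 1, …, 2m} if the tag is set.
    place : ℕ → Bool → ℕ
    place b f = 1 + (b + (m ∸ 1)) % m + (if f then m else 0)

    place-≈ : ∀ b f → place b f ≈ b mod m
    place-≈ b f = begin
      1 + (b + (m ∸ 1)) % m + (if f then m else 0)  ≈⟨ +-≈ (+-≈ (≈-refl {a = 1}) (%-≈ (b + (m ∸ 1)) m)) (offset f) ⟩
      1 + (b + (m ∸ 1)) + 0                         ≡⟨ rearrange b (m ∸ 1) ⟩
      b + (1 + (m ∸ 1))                             ≡⟨ cong (b +_) (m+[n∸m]≡n (>-nonZero⁻¹ m)) ⟩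
      b + m                                         ≈⟨ ∣⇒≈+ b ∣-refl ⟨
      b                                             ∎
      where
      open ≈-Reasoning m
      offset : ∀ f → (if f then m else 0) ≈ 0 mod m
      offset false = ≈-refl
      offset true  = ≈-self
      rearrange : ∀ b k → 1 + (b + k) + 0 ≡ b + (1 + k)
      rearrange = solve-∀

    place≤2m : ∀ b f → place b f ≤ m + m
    place≤2m b f = +-mono-≤ (m%n<n (b + (m ∸ 1)) m) (offset f)
      where
      offset : ∀ f → (if f then m else 0) ≤ m
      offset false = z≤n
      offset true  = ≤-refl

    place-tag : ∀ b b′ f f′ → place b f ≡ place b′ f′ → f ≡ f′
    place-tag b b′ false false e = refl
    place-tag b b′ true  true  e = refl
    place-tag b b′ false true  e = ⊥-elim (<⇒≢ (low<high b b′) e)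
      where
      low<high : ∀ b b′ → place b false < place b′ true
      low<high b b′ = s≤s (≤-trans (≤-reflexive (cong suc (+-identityʳ _))) (≤-trans (m%n<n (b + (m ∸ 1)) m) (m≤n+m m _)))
    place-tag b b′ true false e = sym (place-tag b′ b false true (sym e))

    logExponent : ∀ {x} → ¬ (p ∣ x) → ℕ
    logExponent {x} p∤x = exponent E (proj₁ (discreteLog p∤x)) (even x)

    -- Values of `place` stay in {1, ..., 2m}, so the remaining exponent 2m + 1 = 2p - 1 goes to the
    -- single point p. The decision is an argument so that proofs can split on it.
    σ′ : ∀ x → Dec (p ∣ x) → ℕ
    σ′ x (yes _)  = 1 + (m + m)
    σ′ x (no p∤x) = place (logExponent p∤x) (tag E (proj₁ (discreteLog p∤x)) (even x))

    2p≡ : 2 * p ≡ 2 + (m + m)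
    2p≡ = trans (cong (2 *_) p≡1+m) (double m)
      where
      double : ∀ m → 2 * (1 + m) ≡ 2 + (m + m)
      double = solve-∀

    σ′-range : ∀ x d → InRange (2 * p) (σ′ x d)
    σ′-range x d = lower d , subst (σ′ x d <_) (sym 2p≡) (s≤s (upper d))
      where
      lower : ∀ d → 1 ≤ σ′ x d
      lower (yes _) = s≤s z≤n
      lower (no _)  = s≤s z≤n
      upper : ∀ d → σ′ x d ≤ 1 + (m + m)
      upper (yes _)  = ≤-refl
      upper (no p∤x) = m≤n⇒m≤1+n (place≤2m (logExponent p∤x) _)

    ∣⇒≡p : ∀ {x} → InRange (2 * p) x → p ∣ x → x ≡ p
    ∣⇒≡p (() , _) (divides 0 refl)
    ∣⇒≡p _ (divides 1 refl) = *-identityˡ p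
    ∣⇒≡p (_ , x<2p) (divides (suc (suc k)) refl) = ⊥-elim (<⇒≱ x<2p (*-monoˡ-≤ p (s≤s (s≤s (z≤n {k})))))

    ≈⇒≡2p : ∀ {x y} → InRange (2 * p) x → InRange (2 * p) y → x ≈ y mod p → x ≈ y mod 2 → x ≡ y
    ≈⇒≡2p (_ , x<) (_ , y<) e e₂ = ≈⇒≡ x< y< (≈-crt (prime∤⇒coprime prime[2] p-odd) _ _ e₂ e)

    same-log : ∀ {x y} (p∤x : ¬ (p ∣ x)) (p∤y : ¬ (p ∣ y)) → proj₁ (discreteLog p∤x) ≡ proj₁ (discreteLog p∤y) → x ≈ y mod p
    same-log p∤x p∤y e = ≈-trans (proj₂ (proj₂ (discreteLog p∤x)))
      (≈-trans (≈-reflexive (cong (g ^_) e)) (≈-sym (proj₂ (proj₂ (discreteLog p∤y)))))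

    σ′-injective : ∀ x y d d′ → InRange (2 * p) x → InRange (2 * p) y → σ′ x d ≡ σ′ y d′ → x ≡ y
    σ′-injective x y (yes p∣x) (yes p∣y) x∈ y∈ e = trans (∣⇒≡p x∈ p∣x) (sym (∣⇒≡p y∈ p∣y))
    σ′-injective x y (yes _) (no p∤y) x∈ y∈ e =
      ⊥-elim (<⇒≢ (s≤s (place≤2m (logExponent p∤y) _)) (sym e))
    σ′-injective x y (no p∤x) (yes _) x∈ y∈ e =
      ⊥-elim (<⇒≢ (s≤s (place≤2m (logExponent p∤x) _)) e)
    σ′-injective x y (no p∤x) (no p∤y) x∈ y∈ e = ≈⇒≡2p x∈ y∈ (same-log p∤x p∤y (proj₁ both)) (even-reflects (proj₂ both))
      where
      both : proj₁ (discreteLog p∤x) ≡ proj₁ (discreteLog p∤y) × even x ≡ even y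
      both = tagged-injective E (proj₁ (proj₂ (discreteLog p∤x))) (proj₁ (proj₂ (discreteLog p∤y)))
        (≈-trans (≈-sym (place-≈ (logExponent p∤x) _)) (≈-trans (≈-reflexive e) (place-≈ (logExponent p∤y) _)))
        (place-tag (logExponent p∤x) (logExponent p∤y) _ _ e)

    power-log : ∀ {x} (p∤x : ¬ (p ∣ x)) → x ^ σ′ x (no p∤x) ≈ g ^ (proj₁ (discreteLog p∤x) * logExponent p∤x) mod p
    power-log {x} p∤x = begin
      x ^ s          ≈⟨ ^-≈ s (proj₂ (proj₂ (discreteLog p∤x))) ⟩
      (g ^ i) ^ s    ≡⟨ ^-*-assoc g i s ⟩
      g ^ (i * s)    ≈⟨ ^-cong-exponent (HasOrder.unity order) (*-≈ˡ i (place-≈ (logExponent p∤x) _)) ⟩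
      g ^ (i * logExponent p∤x) ∎
      where
      open ≈-Reasoning p
      i = proj₁ (discreteLog p∤x)
      s = σ′ x (no p∤x)

    -- A positive power keeps parity, so equal values modulo 2p come from points with the same bit.
    -- Modulo p the logarithms of the values are i · exponent, and `product-injective` for that bit
    -- identifies the logarithms of the points.
    power-injective : ∀ x y d d′ → InRange (2 * p) x → InRange (2 * p) y →
      x ^ σ′ x d ≈ y ^ σ′ y d′ mod (2 * p) → x ≡ y
    power-injective x y d d′ x∈ y∈ e = cases d d′ e
      where
      same-parity : ∀ d d′ → x ^ σ′ x d ≈ y ^ σ′ y d′ mod (2 * p) → x ≈ y mod 2
      same-parity d d′ e = ≈-trans (≈-sym (^-parity x (σ′ x d) (proj₁ (σ′-range x d))))
        (≈-trans (≈-weaken (m∣m*n p) e) (^-parity y (σ′ y d′) (proj₁ (σ′-range y d′))))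
      cases : ∀ d d′ → x ^ σ′ x d ≈ y ^ σ′ y d′ mod (2 * p) → x ≡ y
      cases (yes p∣x) (yes p∣y) e = trans (∣⇒≡p x∈ p∣x) (sym (∣⇒≡p y∈ p∣y))
      cases d@(yes p∣x) d′@(no p∤y) e = ⊥-elim (prime∤^ prime p∤y (σ′ y d′)
        (∣-resp-≈ (≈-weaken (n∣m*n 2) e) (∣-^ (σ′ x d) (proj₁ (σ′-range x d)) p∣x)))
      cases d@(no p∤x) d′@(yes p∣y) e = ⊥-elim (prime∤^ prime p∤x (σ′ x d)
        (∣-resp-≈ (≈-weaken (n∣m*n 2) (≈-sym e)) (∣-^ (σ′ y d′) (proj₁ (σ′-range y d′)) p∣y)))
      cases d@(no p∤x) d′@(no p∤y) e = ≈⇒≡2p x∈ y∈ (same-log p∤x p∤y logs) (same-parity d d′ e)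
        where
        j = proj₁ (discreteLog p∤y)
        logs : proj₁ (discreteLog p∤x) ≡ j
        logs = product-injective E (even x) (proj₁ (proj₂ (discreteLog p∤x))) (proj₁ (proj₂ (discreteLog p∤y)))
          (≈-trans (^-injective prime order _ _
            (≈-trans (≈-sym (power-log p∤x)) (≈-trans (≈-weaken (n∣m*n 2) e) (power-log p∤y))))
            (≈-reflexive (cong (λ t → j * exponent E j t) (sym (even-≈ (same-parity d d′ e))))))

    σ : ℕ → ℕ
    σ x = σ′ x (p ∣? x)

    2p∤power : ∀ x → InRange (2 * p) x → ¬ (2 * p ∣ x ^ σ x)
    2p∤power x x∈ 2p∣ = cases (p ∣? x)
      where
      cases : Dec (p ∣ x) → ⊥
      cases (yes p∣x) = prime∤^ prime[2] p-odd (σ x)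
        (subst (λ t → 2 ∣ t ^ σ x) (∣⇒≡p x∈ p∣x) (∣-trans (m∣m*n p) 2p∣))
      cases (no p∤x) = prime∤^ prime p∤x (σ x) (∣-trans (n∣m*n 2) 2p∣)

  existsExpOrthomorphism : ExistsExpOrthomorphism (2 * p)
  existsExpOrthomorphism = σ ,
    injective⇒BijOn (λ x _ → σ′-range x (p ∣? x)) (λ x y → σ′-injective x y (p ∣? x) (p ∣? y)) ,
    injective⇒BijOn (λ x x∈ → ∤⇒range (2p∤power x x∈))
      (λ x y x∈ y∈ e → power-injective x y (p ∣? x) (p ∣? y) x∈ y∈ (%⇒≈ e))

-- Constraints on an orthomorphism

length-cartesianProduct : (xs : List A) (ys : List B) → length (cartesianProduct xs ys) ≡ length xs * length ys
length-cartesianProduct []       ys = refl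
length-cartesianProduct (x ∷ xs) ys = trans (length-++ (map (x ,_) ys))
  (cong₂ _+_ (length-map (x ,_) ys) (length-cartesianProduct xs ys))

∣prime⇒≡ : ∀ {p q} → Prime p → Prime q → q ∣ p → q ≡ p
∣prime⇒≡ prp prq q∣p with prime⇒irreducible prp q∣p
... | inj₁ refl = ⊥-elim (¬prime[1] prq)
... | inj₂ e    = e

odd≡1+2* : ∀ {p} → Odd p → p ≡ 1 + 2 * (p / 2)
odd≡1+2* {p} odd = trans (m≡m%n+[m/n]*n p 2) (cong₂ _+_ (remainder (p % 2) (m%n<n p 2) refl) (*-comm (p / 2) 2))
  where
  remainder : ∀ u → u < 2 → p % 2 ≡ u → p % 2 ≡ 1
  remainder 0 _ e = ⊥-elim (odd (m%n≡0⇒n∣m p 2 e))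
  remainder 1 _ e = e
  remainder (suc (suc _)) (s≤s (s≤s ()))

module Orthomorphism {n : ℕ} (n≢0 : NonZero n) (σ : ℕ → ℕ) (isOrth : IsExpOrthomorphism n {{n≢0}} σ) where

  private
    instance _ = n≢0

  f : ℕ → ℕ
  f x = (x ^ σ x) % n

  σ-range : ∀ {x} → InRange n x → InRange n (σ x)
  σ-range = proj₁ (proj₁ isOrth) _

  σ-injective : ∀ {x y} → InRange n x → InRange n y → σ x ≡ σ y → x ≡ y
  σ-injective = proj₁ (proj₂ (proj₁ isOrth)) _ _

  σ-surjective : ∀ {e} → InRange n e → ∃[ x ] (InRange n x × σ x ≡ e)
  σ-surjective = proj₂ (proj₂ (proj₁ isOrth)) _

  f-range : ∀ {x} → InRange n x → InRange n (f x)
  f-range = proj₁ (proj₂ isOrth) _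

  f-injective : ∀ {x y} → InRange n x → InRange n y → f x ≡ f y → x ≡ y
  f-injective = proj₁ (proj₂ (proj₂ isOrth)) _ _

  f-surjective : ∀ {y} → InRange n y → ∃[ x ] (InRange n x × f x ≡ y)
  f-surjective = proj₂ (proj₂ (proj₂ isOrth)) _

  f≈ : ∀ {d} → d ∣ n → ∀ x → f x ≈ x ^ σ x mod d
  f≈ d∣n x = ≈-weaken d∣n (%-≈ (x ^ σ x) n)

  σ⁻¹ : ℕ → ℕ
  σ⁻¹ e with 1 ≤? e ×-dec e <? n
  ... | yes e∈ = proj₁ (σ-surjective e∈)
  -- A default outside the range makes the inverse total; `σ⁻¹-spec` excludes this case.
  ... | no _   = 0

  σ⁻¹-spec : ∀ {e} → InRange n e → InRange n (σ⁻¹ e) × σ (σ⁻¹ e) ≡ e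
  σ⁻¹-spec {e} e∈ with 1 ≤? e ×-dec e <? n
  ... | yes e∈′ = proj₂ (σ-surjective e∈′)
  ... | no ¬e∈  = ⊥-elim (¬e∈ e∈)

  f-reflects : {P : ℕ → Set} → Decidable P → (∀ {x} → InRange n x → P x → P (f x)) →
    ∀ {x} → InRange n x → P (f x) → P x
  f-reflects P? pres x∈ = reflects P? (range-unique n) (∈-range⁺ ∘ f-range ∘ ∈-range⁻)
    (λ x∈ y∈ → f-injective (∈-range⁻ x∈) (∈-range⁻ y∈)) (pres ∘ ∈-range⁻) (∈-range⁺ x∈)

  -- The N exponents divisible by r produce N distinct nonzero values; 0 is one more.
  values-at-multiples : ∀ r N → .{{_ : NonZero r}} → r * N < n → (g : ℕ → A) →
    (∀ {x y} → x < n → y < n → g x ≡ g y → x ≡ y) → (L : List A) → g 0 ∈ L →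
    (∀ {x} → InRange n x → r ∣ σ x → g (f x) ∈ L) → N < length L
  values-at-multiples {A = A} r N rN<n g g-inj L g0∈ gf∈ =
    subst (_≤ length L) (trans (length-map (g ∘ value) (upTo (suc N))) (length-upTo (suc N)))
      (⊆⇒length≤ (map-unique (Unique.upTo⁺ (suc N)) λ i∈ j∈ → injective (∈-upTo⁻ i∈) (∈-upTo⁻ j∈))
                 (map-⊆ (λ i∈ → member (∈-upTo⁻ i∈))))
    where
    value : ℕ → ℕ
    value zero    = 0
    value (suc i) = f (σ⁻¹ (r * suc i))
    multiple∈ : ∀ {i} → suc i < suc N → InRange n (r * suc i)
    multiple∈ {i} i<N = *-mono-≤ (>-nonZero⁻¹ r) (s≤s z≤n) , ≤-<-trans (*-monoʳ-≤ r (s≤s⁻¹ i<N)) rN<n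
    value∈ : ∀ {i} → suc i < suc N → InRange n (value (suc i))
    value∈ i<N = f-range (proj₁ (σ⁻¹-spec (multiple∈ i<N)))
    value< : ∀ {i} → i < suc N → value i < n
    value< {zero}  _   = >-nonZero⁻¹ n
    value< {suc i} i<N = proj₂ (value∈ i<N)
    value-injective : ∀ {i j} → i < suc N → j < suc N → value i ≡ value j → i ≡ j
    value-injective {zero}  {zero}  _  _  _ = refl
    value-injective {zero}  {suc j} _  j< e = ⊥-elim (<⇒≢ (proj₁ (value∈ j<)) e)
    value-injective {suc i} {zero}  i< _  e = ⊥-elim (<⇒≢ (proj₁ (value∈ i<)) (sym e))
    value-injective {suc i} {suc j} i< j< e = *-cancelˡ-≡ (suc i) (suc j) r (trans (sym σi) (trans (cong σ x≡y) σj))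
      where
      σi = proj₂ (σ⁻¹-spec (multiple∈ i<))
      σj = proj₂ (σ⁻¹-spec (multiple∈ j<))
      x≡y : σ⁻¹ (r * suc i) ≡ σ⁻¹ (r * suc j)
      x≡y = f-injective (proj₁ (σ⁻¹-spec (multiple∈ i<))) (proj₁ (σ⁻¹-spec (multiple∈ j<))) e
    injective : ∀ {i j} → i < suc N → j < suc N → g (value i) ≡ g (value j) → i ≡ j
    injective i< j< e = value-injective i< j< (g-inj (value< i<) (value< j<) e)
    member : ∀ {i} → i < suc N → g (value i) ∈ L
    member {zero}  _  = g0∈
    member {suc i} i< = gf∈ (proj₁ (σ⁻¹-spec (multiple∈ i<))) (subst (r ∣_) (sym (proj₂ (σ⁻¹-spec (multiple∈ i<)))) (m∣m*n (suc i)))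

  -- A value divisible by p comes from a point divisible by p, and any exponent above 1 there would
  -- make the value divisible by p². Hence p and n - p both arise with exponent 1, which occurs only
  -- once. So n = 2p, and p² ∣ 2p leaves p = 2.
  square∣⇒≡4 : ∀ {p} → Prime p → p * p ∣ n → n ≡ 4
  square∣⇒≡4 {p} pr p²∣n = conclude
    where
    instance _ = prime⇒nonZero pr
    p²∤p : ¬ (p * p ∣ p)
    p²∤p d = <⇒≱ (m<m*n p p (prime>1 pr)) (∣⇒≤ d)
    p<n : p < n
    p<n = <-≤-trans (m<m*n p p (prime>1 pr)) (∣⇒≤ p²∣n)
    p∣n : p ∣ n
    p∣n = ∣-trans (m∣m*n p) p²∣n
    ∣∣^ : ∀ {x} k → p ∣ x → 1 ≤ k → k ≡ 1 ⊎ p * p ∣ x ^ k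
    ∣∣^ 1 _ _ = inj₁ refl
    ∣∣^ {x} (suc (suc k)) p∣x _ = inj₂ (*-pres-∣ p∣x (∣m⇒∣m*n (x ^ k) p∣x))
    prime∣^⇒∣ : ∀ {x} k → p ∣ x ^ k → p ∣ x
    prime∣^⇒∣ {x} k d = decidable-stable (p ∣? x) λ p∤x → prime∤^ pr p∤x k d
    exponent-one : ∀ {y} → InRange n y → p ∣ y → ¬ (p * p ∣ y) → ∃[ x ] (InRange n x × f x ≡ y × σ x ≡ 1)
    exponent-one {y} y∈ p∣y p²∤y = x , x∈ , fx≡y , [ (λ e → e) , (λ d → ⊥-elim (p²∤y (subst (p * p ∣_) fx≡y
        (∣-resp-≈ (≈-sym (f≈ p²∣n x)) d)))) ]′ (∣∣^ (σ x) p∣x (proj₁ (σ-range x∈)))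
      where
      x = proj₁ (f-surjective y∈)
      x∈ = proj₁ (proj₂ (f-surjective y∈))
      fx≡y = proj₂ (proj₂ (f-surjective y∈))
      p∣x : p ∣ x
      p∣x = prime∣^⇒∣ (σ x) (∣-resp-≈ (f≈ p∣n x) (subst (p ∣_) (sym fx≡y) p∣y))
    p+[n∸p]≡n : p + (n ∸ p) ≡ n
    p+[n∸p]≡n = m+[n∸m]≡n (<⇒≤ p<n)
    first = exponent-one {p} (<⇒≤ (prime>1 pr) , p<n) ∣-refl p²∤p
    second = exponent-one {n ∸ p} (m<n⇒0<n∸m p<n , ∸-monoʳ-< (>-nonZero⁻¹ p) (<⇒≤ p<n))
      (∣m+n∣m⇒∣n (subst (p ∣_) (sym p+[n∸p]≡n) p∣n) ∣-refl)
      (λ d → p²∤p (∣m+n∣m⇒∣n (subst (p * p ∣_) (trans (sym p+[n∸p]≡n) (+-comm p (n ∸ p))) p²∣n) d))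
    n≡2p : n ≡ 2 * p
    n≡2p = begin
      n              ≡⟨ p+[n∸p]≡n ⟨
      p + (n ∸ p)    ≡⟨ cong (p +_) (proj₁ (proj₂ (proj₂ second))) ⟨
      p + f (proj₁ second) ≡⟨ cong (λ x → p + f x) (σ-injective (proj₁ (proj₂ first)) (proj₁ (proj₂ second))
                                (trans (proj₂ (proj₂ (proj₂ first))) (sym (proj₂ (proj₂ (proj₂ second)))))) ⟨
      p + f (proj₁ first)  ≡⟨ cong (p +_) (proj₁ (proj₂ (proj₂ first))) ⟩
      p + p          ≡⟨ cong (p +_) (+-identityʳ p) ⟨
      2 * p          ∎
      where open ≡-Reasoning
    p≡2 : p ≡ 2
    p≡2 = ∣prime⇒≡ prime[2] pr (*-cancelʳ-∣ p (subst (p * p ∣_) n≡2p p²∣n))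
    conclude : n ≡ 4
    conclude = trans n≡2p (cong (2 *_) p≡2)

  -- If r² divides p − 1 and r divides σ(x), then f(x) is an r²-th power residue modulo p (or 0):
  -- it is an r-th power residue, and f permutes these, so x is one as well.
  predecessor-squarefree : ∀ {p r} → Prime p → p ∣ n → Prime r → ¬ (r * r ∣ p ∸ 1)
  predecessor-squarefree {p} {r} pr (divides c n≡cp) prr (divides k p-1≡krr) =
    <⇒≱ too-many (values-at-multiples r (c * (k * r)) {{prime⇒nonZero prr}} fits coordinates coordinates-injective L zero∈ values)
    where
    instance _ = prime⇒nonZero pr
    p∣n : p ∣ n
    p∣n = divides c n≡cp
    p-1≢0 : p ∸ 1 ≢ 0
    p-1≢0 e = <⇒≢ (m<n⇒0<n∸m (prime>1 pr)) (sym e)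
    k>0 : 0 < k
    k>0 = n≢0⇒n>0 λ { refl → p-1≢0 p-1≡krr }
    c>0 : 0 < c
    c>0 = n≢0⇒n>0 λ { refl → ≢-nonZero⁻¹ n n≡cp }
    instance _ = >-nonZero k>0
    -- Here p - 1 = k r². Among nonzero residues the r-th powers are the roots of X^(kr) - 1 and the
    -- r²-th powers those of X^k - 1, so `Power` is used with d = kr and d = k.
    Power : ℕ → ℕ → Set
    Power d y = p ∣ y ⊎ y ^ d ≈ 1 mod p
    power? : ∀ d → Decidable (Power d)
    power? d y = p ∣? y ⊎-dec y ^ d ≈? 1 mod p
    pow : ∀ x s d → f x ≈ x ^ s mod p → f x ^ d ≈ x ^ (s * d) mod p
    pow x s d e = ≈-trans (^-≈ d e) (≈-reflexive (^-*-assoc x s d))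
    p∣f : ∀ {x} → InRange n x → p ∣ x → p ∣ f x
    p∣f {x} x∈ p∣x = ∣-resp-≈ (≈-sym (f≈ p∣n x)) (∣-^ (σ x) (proj₁ (σ-range x∈)) p∣x)
    preserved : ∀ {x} → InRange n x → Power (k * r) x → Power (k * r) (f x)
    preserved x∈ (inj₁ p∣x) = inj₁ (p∣f x∈ p∣x)
    preserved {x} x∈ (inj₂ e) = inj₂ (≈-trans (pow x (σ x) (k * r) (f≈ p∣n x)) (^*-≈1 x (k * r) e (σ x)))
    f-power : ∀ {x} → InRange n x → r ∣ σ x → Power (k * r) (f x)
    f-power {x} x∈ (divides i σx≡ir) = cases (p ∣? x)
      where
      rearrange : ∀ i k r → i * r * (k * r) ≡ i * (k * (r * r))
      rearrange = solve-∀
      cases : Dec (p ∣ x) → Power (k * r) (f x)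
      cases (yes p∣x) = inj₁ (p∣f x∈ p∣x)
      cases (no p∤x)  = inj₂ (begin
        f x ^ (k * r)              ≈⟨ pow x (σ x) (k * r) (f≈ p∣n x) ⟩
        x ^ (σ x * (k * r))        ≡⟨ cong (λ s → x ^ (s * (k * r))) σx≡ir ⟩
        x ^ (i * r * (k * r))      ≡⟨ cong (x ^_) (trans (rearrange i k r) (cong (i *_) (sym p-1≡krr))) ⟩
        x ^ (i * (p ∸ 1))          ≈⟨ ^*-≈1 x (p ∸ 1) (fermat pr p∤x) i ⟩
        1                          ∎)
        where open ≈-Reasoning p
    f-square-power : ∀ {x} → InRange n x → r ∣ σ x → Power k (f x)
    f-square-power {x} x∈ r∣σx@(divides i σx≡ir) = cases (f-reflects (power? (k * r)) preserved x∈ (f-power x∈ r∣σx))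
      where
      rearrange : ∀ i k r → i * r * k ≡ i * (k * r)
      rearrange = solve-∀
      cases : Power (k * r) x → Power k (f x)
      cases (inj₁ p∣x) = inj₁ (p∣f x∈ p∣x)
      cases (inj₂ e) = inj₂ (begin
        f x ^ k            ≈⟨ pow x (σ x) k (f≈ p∣n x) ⟩
        x ^ (σ x * k)      ≡⟨ cong (λ s → x ^ (s * k)) σx≡ir ⟩
        x ^ (i * r * k)    ≡⟨ cong (x ^_) (rearrange i k r) ⟩
        x ^ (i * (k * r))  ≈⟨ ^*-≈1 x (k * r) e i ⟩
        1                  ∎)
        where open ≈-Reasoning p
    root? : ∀ y → Dec (y ^ k ≈ 1 mod p)
    root? y = y ^ k ≈? 1 mod p
    roots residues : List ℕ
    roots = filter root? (upTo p)
    residues = 0 ∷ roots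
    L : List (ℕ × ℕ)
    L = cartesianProduct (upTo c) residues
    -- With n = cp, the quotient by p takes c values and the remainder of a counted value lies among
    -- 0 and the at most k roots.
    coordinates : ℕ → ℕ × ℕ
    coordinates y = y / p , y % p
    coordinates-injective : ∀ {x y} → x < n → y < n → coordinates x ≡ coordinates y → x ≡ y
    coordinates-injective {x} {y} _ _ e = trans (m≡m%n+[m/n]*n x p)
      (trans (cong₂ (λ u v → v + u * p) (cong proj₁ e) (cong proj₂ e)) (sym (m≡m%n+[m/n]*n y p)))
    residue : ∀ {y} → Power k y → y % p ∈ residues
    residue {y} (inj₁ p∣y) = subst (_∈ residues) (sym (n∣m⇒m%n≡0 y p p∣y)) (here refl)
    residue {y} (inj₂ e)   = there (∈-filter⁺ root? (∈-upTo⁺ (m%n<n y p)) (≈-trans (^-≈ k (%-≈ y p)) e))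
    values : ∀ {x} → InRange n x → r ∣ σ x → coordinates (f x) ∈ L
    values {x} x∈ r∣σx = ∈-cartesianProduct⁺ {xs = upTo c} {ys = residues}
      (∈-upTo⁺ (m<n*o⇒m/o<n {f x} {c} (subst (f x <_) n≡cp (proj₂ (f-range x∈)))))
      (residue (f-square-power x∈ r∣σx))
    zero∈ : coordinates 0 ∈ L
    zero∈ = subst (_∈ L) (sym (cong₂ _,_ (0/n≡0 p) (n∣m⇒m%n≡0 0 p (p ∣0))))
      (∈-cartesianProduct⁺ {xs = upTo c} {ys = residues} (∈-upTo⁺ c>0) (here refl))
    root∈⁻ : ∀ {y} → y ∈ roots → y < p × y ^ k ≈ 1 mod p
    root∈⁻ y∈ = ∈-upTo⁻ (proj₁ (∈-filter⁻ root? {xs = upTo p} y∈)) , proj₂ (∈-filter⁻ root? {xs = upTo p} y∈)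
    length-L : length L ≤ c * (1 + k)
    length-L = ≤-trans (≤-reflexive (trans (length-cartesianProduct (upTo c) residues) (cong (_* length residues) (length-upTo c))))
      (*-monoʳ-≤ c (s≤s (length-unity-roots pr k (Unique.filter⁺ root? {xs = upTo p} (Unique.upTo⁺ p)) root∈⁻)))
    -- The count is c(1 + k) ≤ 2ck ≤ ckr, whereas the ckr positive multiples of r up to c(p - 1),
    -- together with 0, require 1 + ckr values.
    too-many : length L < suc (c * (k * r))
    too-many = s≤s (≤-trans length-L (*-monoʳ-≤ c
      (≤-trans (+-monoˡ-≤ k k>0) (≤-trans (≤-reflexive (double k)) (*-monoʳ-≤ k (prime>1 prr))))))
      where
      double : ∀ k → k + k ≡ k * 2
      double = solve-∀
    fits : r * (c * (k * r)) < n
    fits = subst₂ _<_ (trans (cong (c *_) p-1≡krr) (rearrange c k r)) (sym n≡cp)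
      (*-monoʳ-< c {{>-nonZero c>0}} (∸-monoʳ-< z<s (<⇒≤ (prime>1 pr))))
      where
      rearrange : ∀ c k r → c * (k * (r * r)) ≡ r * (c * (k * r))
      rearrange = solve-∀

  -- The ⌈n/2⌉ − 1 even exponents give distinct nonzero squares modulo n, but at most
  -- (p + 1)/2 · (q + 1)/2 · s residues, 0 included, are squares.
  ¬two-odd-primes : ∀ {p q} → Prime p → Prime q → Odd p → Odd q → p ≢ q → ∀ s → n ≢ s * (p * q)
  ¬two-odd-primes {p} {q} prp prq p-odd q-odd p≢q s n≡ =
    <⇒≱ too-many (values-at-multiples 2 N fits coordinates (λ _ _ → coordinates-injective) L zero∈ values)
    where
    instance
      _ = prime⇒nonZero prp
      _ = prime⇒nonZero prq
      _ = m*n≢0 p q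
    h : ℕ → ℕ
    h p = p / 2
    N = (n ∸ 1) / 2
    p∣n : p ∣ n
    p∣n = subst (p ∣_) (sym n≡) (∣n⇒∣m*n s (m∣m*n q))
    q∣n : q ∣ n
    q∣n = subst (q ∣_) (sym n≡) (∣n⇒∣m*n s (n∣m*n p))
    coprime : Coprime p q
    coprime = prime∤⇒coprime prp λ p∣q → p≢q (∣prime⇒≡ prq prp p∣q)
    fits : 2 * N < n
    fits = ≤-<-trans (subst (_≤ n ∸ 1) (*-comm N 2) (m/n*n≤m (n ∸ 1) 2)) (∸-monoʳ-< z<s (>-nonZero⁻¹ n))
    n≤2[1+N] : n ≤ 2 * (1 + N)
    n≤2[1+N] = subst (n ≤_) (double N) (begin
      n                              ≡⟨ m+[n∸m]≡n (>-nonZero⁻¹ n) ⟨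
      1 + (n ∸ 1)                    ≡⟨ cong suc (m≡m%n+[m/n]*n (n ∸ 1) 2) ⟩
      1 + ((n ∸ 1) % 2 + N * 2)      ≤⟨ s≤s (+-monoˡ-≤ (N * 2) (s≤s⁻¹ (m%n<n (n ∸ 1) 2))) ⟩
      2 + N * 2                      ∎)
      where
      open ≤-Reasoning
      double : ∀ N → 2 + N * 2 ≡ 2 * (1 + N)
      double = solve-∀
    squares : ∀ p .{{_ : NonZero p}} → List ℕ
    squares p = map (λ i → i * i % p) (upTo (1 + h p))
    length-squares : ∀ p .{{_ : NonZero p}} → length (squares p) ≡ 1 + h p
    length-squares p = trans (length-map (λ i → i * i % p) (upTo (1 + h p))) (length-upTo (1 + h p))
    -- Since u and p - u have the same square, the squares of 0, ..., (p - 1)/2 are all of them.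
    square∈ : ∀ p .{{_ : NonZero p}} → Odd p → ∀ t → t * t % p ∈ squares p
    square∈ p odd t = subst (_∈ squares p) (≈⇒% (*-≈ (%-≈ t p) (%-≈ t p))) (cases (u ≤? h p))
      where
      u v : ℕ
      u = t % p
      v = p ∸ u
      u+v≡p : u + v ≡ p
      u+v≡p = m+[n∸m]≡n (m%n≤n t p)
      intro : ∀ i → i ≤ h p → i * i % p ∈ squares p
      intro i i≤ = ∈-map⁺ (λ i → i * i % p) (∈-upTo⁺ (s≤s i≤))
      -- Adding uv to each side gives v(u + v) and u(u + v), both multiples of u + v = p.
      v²≈u² : v * v ≈ u * u mod p
      v²≈u² = +-cancelˡ-≈ (u * v) (≈-trans (≈-reflexive (factor u v))
        (≈-trans (∣⇒≈0 (∣n⇒∣m*n v (subst (p ∣_) (sym u+v≡p) ∣-refl)))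
        (≈-trans (≈-sym (∣⇒≈0 (∣n⇒∣m*n u (subst (p ∣_) (sym u+v≡p) ∣-refl)))) (≈-reflexive (factor′ u v)))))
        where
        factor : ∀ u v → u * v + v * v ≡ v * (u + v)
        factor = solve-∀
        factor′ : ∀ u v → u * (u + v) ≡ u * v + u * u
        factor′ = solve-∀
      v≤ : h p < u → v ≤ h p
      v≤ h<u = +-cancelˡ-≤ (1 + h p) v (h p) (begin
        1 + h p + v    ≤⟨ +-monoˡ-≤ v h<u ⟩
        u + v          ≡⟨ trans u+v≡p (odd≡1+2* odd) ⟩
        1 + 2 * h p    ≡⟨ double (h p) ⟩
        1 + h p + h p  ∎)
        where
        open ≤-Reasoning
        double : ∀ k → 1 + 2 * k ≡ 1 + k + k
        double = solve-∀
      cases : Dec (u ≤ h p) → u * u % p ∈ squares p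
      cases (yes u≤h) = intro u u≤h
      cases (no u≰h)  = subst (_∈ squares p) (≈⇒% v²≈u²) (intro v (v≤ (≰⇒> u≰h)))
    coordinates : ℕ → (ℕ × ℕ) × ℕ
    coordinates y = (y % p , y % q) , y / (p * q)
    coordinates-injective : ∀ {x y} → coordinates x ≡ coordinates y → x ≡ y
    coordinates-injective {x} {y} e = trans (m≡m%n+[m/n]*n x (p * q))
      (trans (cong₂ (λ u v → u + v * (p * q))
        (≈⇒% (≈-crt coprime x y (%⇒≈ (cong (proj₁ ∘ proj₁) e)) (%⇒≈ (cong (proj₂ ∘ proj₁) e)))) (cong proj₂ e))
      (sym (m≡m%n+[m/n]*n y (p * q))))
    L : List ((ℕ × ℕ) × ℕ)
    L = cartesianProduct (cartesianProduct (squares p) (squares q)) (upTo s)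
    square⇒∈ : ∀ y t → y < n → y ≈ t * t mod n → coordinates y ∈ L
    square⇒∈ y t y<n e = ∈-cartesianProduct⁺ {xs = cartesianProduct (squares p) (squares q)} {ys = upTo s}
      (∈-cartesianProduct⁺ {xs = squares p} {ys = squares q}
        (subst (_∈ squares p) (≈⇒% (≈-weaken p∣n (≈-sym e))) (square∈ p p-odd t))
        (subst (_∈ squares q) (≈⇒% (≈-weaken q∣n (≈-sym e))) (square∈ q q-odd t)))
      (∈-upTo⁺ (m<n*o⇒m/o<n {y} {s} (subst (y <_) n≡ y<n)))
    zero∈ : coordinates 0 ∈ L
    zero∈ = square⇒∈ 0 0 (>-nonZero⁻¹ n) ≈-refl
    values : ∀ {x} → InRange n x → 2 ∣ σ x → coordinates (f x) ∈ L
    values {x} x∈ (divides i e) = square⇒∈ (f x) (x ^ i) (proj₂ (f-range x∈)) (≈-trans (f≈ ∣-refl x)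
      (≈-reflexive (trans (cong (x ^_) e) (trans (sym (^-*-assoc x i 2)) (cong (x ^ i *_) (*-identityʳ (x ^ i)))))))
    length-L : length L ≡ (1 + h p) * (1 + h q) * s
    length-L = trans (length-cartesianProduct (cartesianProduct (squares p) (squares q)) (upTo s))
      (cong₂ _*_ (trans (length-cartesianProduct (squares p) (squares q)) (cong₂ _*_ (length-squares p) (length-squares q)))
                 (length-upTo s))
    half>0 : ∀ {p} → Prime p → Odd p → 0 < h p
    half>0 {p} pr odd = n≢0⇒n>0 λ e → <⇒≢ (prime>1 pr) (sym (trans (odd≡1+2* odd) (cong (λ k → 1 + 2 * k) e)))
    -- The right side exceeds the left by 2ab - 1.
    few-squares : ∀ a b → 0 < a → 0 < b → 2 * ((1 + a) * (1 + b)) < (1 + 2 * a) * (1 + 2 * b)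
    few-squares (suc a) (suc b) _ _ = subst (2 * ((2 + a) * (2 + b)) <_) (expand a b) (m≤m+n _ _)
      where
      expand : ∀ a b → suc (2 * ((2 + a) * (2 + b))) + (2 * a + 2 * b + 2 * (a * b)) ≡ (1 + 2 * (1 + a)) * (1 + 2 * (1 + b))
      expand = solve-∀
    too-many : length L < suc N
    too-many = *-cancelˡ-< 2 (length L) (1 + N) (<-≤-trans (begin-strict
      2 * length L                            ≡⟨ cong (2 *_) length-L ⟩
      2 * ((1 + h p) * (1 + h q) * s)         ≡⟨ rearrange ((1 + h p) * (1 + h q)) s ⟩
      s * (2 * ((1 + h p) * (1 + h q)))       <⟨ *-monoʳ-< s {{s≢0}} (few-squares (h p) (h q) (half>0 prp p-odd) (half>0 prq q-odd)) ⟩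
      s * ((1 + 2 * h p) * (1 + 2 * h q))     ≡⟨ cong (s *_) (cong₂ _*_ (odd≡1+2* p-odd) (odd≡1+2* q-odd)) ⟨
      s * (p * q)                             ≡⟨ n≡ ⟨
      n                                       ∎) n≤2[1+N])
      where
      open ≤-Reasoning
      s≢0 : NonZero s
      s≢0 = ≢-nonZero λ { refl → ≢-nonZero⁻¹ n n≡ }
      rearrange : ∀ x s → 2 * (x * s) ≡ s * (2 * x)
      rearrange = solve-∀

  -- On the subgroup of order q of the units modulo n the orthomorphism would be a complete
  -- mapping of the multiplicative monoid of residues modulo q.
  prime-modulus⇒predecessor∤ : ∀ r → NonZero r → Prime n → Prime (2 + r) → ¬ (2 + r ∣ n ∸ 1)
  prime-modulus⇒predecessor∤ r r≢0 prn prq (divides D n-1≡Dq) =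
    OddPrime.no-multiplicative-complete-mapping r r≢0 prq κ (λ {i} _ → proj₁ (proj₂ (logarithm i)))
      (λ {i} {j} i< j< e → x-injective i< j< (≈⇒≡ (proj₂ (x-range i)) (proj₂ (x-range j))
        (≈-trans (x≈ i) (≈-trans (≈-reflexive (cong (z ^_) e)) (≈-sym (x≈ j))))))
      (λ {i} {j} i< j< e → x-injective i< j< (f-injective (x-range i) (x-range j) (≈⇒%
        (≈-trans (power i) (≈-trans (^-cong-exponent (HasOrder.unity order) (*-≈ˡ D e)) (≈-sym (power j)))))))
    where
    q : ℕ
    q = 2 + r
    z : ℕ
    z = proj₁ (∃-prime-order prn prq (divides D n-1≡Dq))
    order : HasOrder n z q
    order = proj₂ (∃-prime-order prn prq (divides D n-1≡Dq))
    D>0 : 0 < D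
    D>0 = n≢0⇒n>0 λ { refl → <⇒≢ (m<n⇒0<n∸m (prime>1 prn)) (sym n-1≡Dq) }
    instance _ = >-nonZero D>0
    -- The multiples D, 2D, ..., qD = n - 1 are indexed by residues modulo q. Residue 0 is
    -- represented by q because 0 is not an available exponent.
    multiple : ℕ → ℕ
    multiple zero    = q
    multiple (suc i) = suc i
    multiple≈ : ∀ i → multiple i ≈ i mod q
    multiple≈ zero    = ≈-self
    multiple≈ (suc i) = ≈-refl
    multiple-range : ∀ i → i < q → 0 < multiple i × multiple i ≤ q
    multiple-range zero    _   = z<s , ≤-refl
    multiple-range (suc i) i<q = z<s , <⇒≤ i<q
    e : ℕ → ℕ
    e i = D * multiple (i % q)
    e-range : ∀ i → InRange n (e i)
    e-range i = *-mono-≤ D>0 (proj₁ (multiple-range (i % q) (m%n<n i q))) ,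
      ≤-<-trans (≤-trans (*-monoʳ-≤ D (proj₂ (multiple-range (i % q) (m%n<n i q)))) (≤-reflexive (sym n-1≡Dq)))
        (∸-monoʳ-< z<s (<⇒≤ (prime>1 prn)))
    e≈ : ∀ i → e i ≈ D * i mod q
    e≈ i = *-≈ˡ D (≈-trans (multiple≈ (i % q)) (%-≈ i q))
    x : ℕ → ℕ
    x i = σ⁻¹ (e i)
    x-range : ∀ i → InRange n (x i)
    x-range i = proj₁ (σ⁻¹-spec (e-range i))
    σx≡e : ∀ i → σ (x i) ≡ e i
    σx≡e i = proj₂ (σ⁻¹-spec (e-range i))
    x-injective : ∀ {i j} → i < q → j < q → x i ≡ x j → i ≡ j
    x-injective {i} {j} i< j< eq = ≈⇒≡ i< j< (≈-trans (index i) (≈-trans (≈-reflexive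
      (*-cancelˡ-≡ (multiple (i % q)) (multiple (j % q)) D (trans (sym (σx≡e i)) (trans (cong σ eq) (σx≡e j))))) (≈-sym (index j))))
      where
      index : ∀ i → i ≈ multiple (i % q) mod q
      index i = ≈-sym (≈-trans (multiple≈ (i % q)) (%-≈ i q))
    preserved : ∀ {y} → InRange n y → y ^ q ≈ 1 mod n → f y ^ q ≈ 1 mod n
    preserved {y} _ eq = ≈-trans (^-≈ q (f≈ ∣-refl y))
      (≈-trans (≈-reflexive (^-*-assoc y (σ y) q)) (^*-≈1 y q eq (σ y)))
    f-root : ∀ i → f (x i) ^ q ≈ 1 mod n
    f-root i = begin
      f (x i) ^ q                        ≈⟨ ^-≈ q (f≈ ∣-refl (x i)) ⟩
      (x i ^ σ (x i)) ^ q                ≡⟨ ^-*-assoc (x i) (σ (x i)) q ⟩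
      x i ^ (σ (x i) * q)                ≡⟨ cong (λ s → x i ^ (s * q)) (σx≡e i) ⟩
      x i ^ (D * multiple (i % q) * q)   ≡⟨ cong (x i ^_) (trans (rearrange D (multiple (i % q)) q) (cong (multiple (i % q) *_) (sym n-1≡Dq))) ⟩
      x i ^ (multiple (i % q) * (n ∸ 1)) ≈⟨ ^*-≈1 (x i) (n ∸ 1) (fermat prn (range⇒∤ (x-range i))) (multiple (i % q)) ⟩
      1                                  ∎
      where
      open ≈-Reasoning n
      rearrange : ∀ a b c → a * b * c ≡ b * (a * c)
      rearrange = solve-∀
    -- An exponent divisible by D puts the value in the subgroup of order q. As `f` maps that
    -- subgroup into itself, the point already lies there.
    x-root : ∀ i → x i ^ q ≈ 1 mod n
    x-root i = f-reflects (λ y → y ^ q ≈? 1 mod n) preserved (x-range i) (f-root i)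
    logarithm : ∀ i → ∃[ k ] (k < q × x i ≈ z ^ k mod n)
    logarithm i = roots-are-powers prn order (x i) (x-root i)
    -- The logarithm of the point with exponent Di. The value there is z^(D i κ(i)), so equal
    -- products i κ(i) modulo q give equal values of `f`.
    κ : ℕ → ℕ
    κ i = proj₁ (logarithm i)
    x≈ : ∀ i → x i ≈ z ^ κ i mod n
    x≈ i = proj₂ (proj₂ (logarithm i))
    power : ∀ i → x i ^ σ (x i) ≈ z ^ (D * (i * κ i)) mod n
    power i = begin
      x i ^ σ (x i)          ≈⟨ ^-≈ (σ (x i)) (x≈ i) ⟩
      (z ^ κ i) ^ σ (x i)    ≡⟨ ^-*-assoc z (κ i) (σ (x i)) ⟩
      z ^ (κ i * σ (x i))    ≡⟨ cong (λ s → z ^ (κ i * s)) (σx≡e i) ⟩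
      z ^ (κ i * e i)        ≈⟨ ^-cong-exponent (HasOrder.unity order) (*-≈ˡ (κ i) (e≈ i)) ⟩
      z ^ (κ i * (D * i))    ≡⟨ cong (z ^_) (rearrange (κ i) D i) ⟩
      z ^ (D * (i * κ i))    ∎
      where
      open ≈-Reasoning n
      rearrange : ∀ a b c → a * (b * c) ≡ b * (c * a)
      rearrange = solve-∀

-- From the constraints to the admissible moduli

primeDivisor : ∀ k → 1 < k → ∃[ q ] (Prime q × q ∣ k)
primeDivisor k 1<k = first (factorise k {{>-nonZero (<-trans z<s 1<k)}})
  where
  first : PrimeFactorisation k → ∃[ q ] (Prime q × q ∣ k)
  first record { factors = [] ; isFactorisation = refl } = ⊥-elim (<-irrefl refl 1<k)
  first record { factors = q ∷ qs ; isFactorisation = e ; factorsPrime = pr ∷ _ } =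
    q , pr , subst (q ∣_) (sym e) (m∣m*n (product qs))

squarefree-product⇒unique : ∀ {qs} → All Prime qs → (∀ {r} → Prime r → ¬ (r * r ∣ product qs)) → Unique qs
squarefree-product⇒unique [] sqf = []
squarefree-product⇒unique {q ∷ qs} (pr ∷ prs) sqf =
  All.tabulate (λ { y∈ refl → sqf pr (*-monoʳ-∣ q (∈⇒∣product y∈)) })
  ∷ squarefree-product⇒unique prs λ prr d → sqf prr (∣n⇒∣m*n q d)

∣⇒odd : ∀ {q h} → Prime q → ¬ (2 ∣ h) → q ∣ h → Odd q
∣⇒odd {q} {h} pr h-odd q∣h 2∣q = h-odd (subst (_∣ h) (sym (∣prime⇒≡ pr prime[2] 2∣q)) q∣h)

-- The primes are the factors of h = (p - 1)/2. They are odd because 4 ∤ p - 1, and distinct because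
-- a repeated factor would give a square divisor.
goodPrimeShape : ∀ {p} → Prime p → Odd p → (∀ {r} → Prime r → ¬ (r * r ∣ p ∸ 1)) → GoodPrimeShape p
goodPrimeShape {p} pr p-odd sqf = factors , factorsPrime , odd , squarefree-product⇒unique factorsPrime sqf′ ,
  trans p-1≡2h (cong (2 *_) isFactorisation)
  where
  h = p / 2
  p-1≡2h : p ∸ 1 ≡ 2 * h
  p-1≡2h = cong (_∸ 1) (odd≡1+2* p-odd)
  h≢0 : NonZero h
  h≢0 = ≢-nonZero λ e → <⇒≢ (m<n⇒0<n∸m (prime>1 pr)) (sym (trans p-1≡2h (cong (2 *_) e)))
  open PrimeFactorisation (factorise h {{h≢0}})
  sqf′ : ∀ {r} → Prime r → ¬ (r * r ∣ product factors)
  sqf′ {r} prr d = sqf prr (subst (r * r ∣_) (sym p-1≡2h) (∣n⇒∣m*n 2 (subst (r * r ∣_) (sym isFactorisation) d)))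
  h-odd : ¬ (2 ∣ h)
  h-odd d = sqf prime[2] (subst (4 ∣_) (sym p-1≡2h) (*-monoʳ-∣ 2 d))
  odd : All Odd factors
  odd = All.tabulate λ {q} q∈ → ∣⇒odd (All.lookup factorsPrime q∈) h-odd (subst (q ∣_) (sym isFactorisation) (∈⇒∣product q∈))

module Necessity {n : ℕ} (n≢0 : NonZero n) (1<n : 1 < n) (σ : ℕ → ℕ) (isOrth : IsExpOrthomorphism n {{n≢0}} σ) where

  private
    open Orthomorphism n≢0 σ isOrth

    -- Write n = 1 + 2h. Squarefreeness of n - 1 makes h odd, so h > 1 would have an odd prime
    -- divisor, contrary to `prime-modulus⇒predecessor∤`. Hence h = 1.
    prime-modulus : Prime n → Odd n → n ≡ 3
    prime-modulus pr n-odd = decidable-stable (n ≟ 3) λ n≢3 → no-divisor n≢3 (primeDivisor h (1<h n≢3))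
      where
      h = n / 2
      n≡1+2h : n ≡ 1 + 2 * h
      n≡1+2h = odd≡1+2* n-odd
      n-1≡2h : n ∸ 1 ≡ 2 * h
      n-1≡2h = cong (_∸ 1) n≡1+2h
      1<h : n ≢ 3 → 1 < h
      1<h n≢3 = ≤∧≢⇒< (n≢0⇒n>0 λ e → <⇒≢ 1<n (sym (trans n≡1+2h (cong (λ k → 1 + 2 * k) e))))
        λ e → n≢3 (trans n≡1+2h (cong (λ k → 1 + 2 * k) (sym e)))
      h-odd : ¬ (2 ∣ h)
      h-odd d = predecessor-squarefree pr ∣-refl prime[2] (subst (4 ∣_) (sym n-1≡2h) (*-monoʳ-∣ 2 d))
      no-odd : ∀ q → Prime q → Odd q → ¬ (q ∣ n ∸ 1)
      no-odd 0 prq _ _ = ¬prime[0] prq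
      no-odd 1 prq _ _ = ¬prime[1] prq
      no-odd 2 _ odd _ = odd ∣-refl
      no-odd (suc (suc (suc r))) prq _ = prime-modulus⇒predecessor∤ (suc r) _ pr prq
      no-divisor : n ≢ 3 → ¬ (∃[ q ] (Prime q × q ∣ h))
      no-divisor _ (q , prq , q∣h) = no-odd q prq (∣⇒odd prq h-odd q∣h) (subst (q ∣_) (sym n-1≡2h) (∣n⇒∣m*n 2 q∣h))

    module Squarefree (n≢4 : n ≢ 4) where

      sqf : ∀ {p} → Prime p → ¬ (p * p ∣ n)
      sqf pr d = n≢4 (square∣⇒≡4 pr d)

      -- A prime q ≠ p would be a second odd prime divisor of n, and q = p would give p² ∣ n.
      cofactor-prime-free : ∀ {p s} → Prime p → Odd p → n ≡ s * p → ∀ {q} → Prime q → Odd q → ¬ (q ∣ s)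
      cofactor-prime-free {p} pr p-odd refl {q} prq q-odd (divides t refl) =
        ¬two-odd-primes prq pr q-odd p-odd q≢p t (*-assoc t q p)
        where
        q≢p : q ≢ p
        q≢p refl = sqf pr (divides t (*-assoc t q q))

      even-case : ∀ k → n ≡ k * 2 → Admissible n
      even-case 0 e = ⊥-elim (≢-nonZero⁻¹ n {{n≢0}} e)
      even-case 1 e = inj₁ e
      even-case k@(suc (suc _)) e = from-divisor (primeDivisor k (s≤s (s≤s z≤n)))
        where
        k-odd : ¬ (2 ∣ k)
        k-odd d = sqf prime[2] (subst (4 ∣_) (sym e) (*-monoˡ-∣ 2 d))
        from-divisor : ∃[ p ] (Prime p × p ∣ k) → Admissible n
        from-divisor (p , pr , divides s k≡sp) = cofactor s k≡sp
          where
          p-odd : Odd p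
          p-odd = ∣⇒odd pr k-odd (divides s k≡sp)
          n≡ : ∀ s → k ≡ s * p → n ≡ s * 2 * p
          n≡ s k≡sp = trans e (trans (cong (_* 2) k≡sp) (rearrange s p))
            where
            rearrange : ∀ s p → s * p * 2 ≡ s * 2 * p
            rearrange = solve-∀
          p∣n : p ∣ n
          p∣n = divides (s * 2) (n≡ s k≡sp)
          cofactor : ∀ s → k ≡ s * p → Admissible n
          cofactor 0 ()
          cofactor 1 k≡p = inj₂ (inj₂ (inj₂ (p , pr , p-odd ,
            goodPrimeShape pr p-odd (predecessor-squarefree pr p∣n) , n≡ 1 k≡p)))
          cofactor s@(suc (suc _)) k≡sp = ⊥-elim (contradict (primeDivisor s (s≤s (s≤s z≤n))))
            where
            contradict : ¬ (∃[ q ] (Prime q × q ∣ s))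
            contradict (q , prq , q∣s) = cofactor-prime-free pr p-odd (n≡ s k≡sp) prq
              (∣⇒odd prq k-odd (subst (q ∣_) (sym k≡sp) (∣m⇒∣m*n p q∣s))) (∣m⇒∣m*n 2 q∣s)

      odd-case : Odd n → Admissible n
      odd-case n-odd = from-divisor (primeDivisor n 1<n)
        where
        from-divisor : ∃[ p ] (Prime p × p ∣ n) → Admissible n
        from-divisor (p , pr , divides s n≡sp) = cofactor s n≡sp
          where
          p-odd : Odd p
          p-odd = ∣⇒odd pr n-odd (divides s n≡sp)
          cofactor : ∀ s → n ≡ s * p → Admissible n
          cofactor 0 e = ⊥-elim (≢-nonZero⁻¹ n {{n≢0}} e)
          cofactor 1 e = inj₂ (inj₁ (prime-modulus (subst Prime (sym (trans e (*-identityˡ p))) pr) n-odd))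
          cofactor s@(suc (suc _)) e = ⊥-elim (contradict (primeDivisor s (s≤s (s≤s z≤n))))
            where
            contradict : ¬ (∃[ q ] (Prime q × q ∣ s))
            contradict (q , prq , q∣s) = cofactor-prime-free pr p-odd e prq
              (∣⇒odd prq n-odd (subst (q ∣_) (sym e) (∣m⇒∣m*n p q∣s))) q∣s

      squarefree-admissible : Admissible n
      squarefree-admissible = cases (2 ∣? n)
        where
        cases : Dec (2 ∣ n) → Admissible n
        cases (yes (divides k e)) = even-case k e
        cases (no n-odd)          = odd-case n-odd

  admissible : Admissible n
  admissible = cases (n ≟ 4)
    where
    cases : Dec (n ≡ 4) → Admissible n
    cases (yes n≡4) = inj₂ (inj₂ (inj₁ n≡4))
    cases (no n≢4)  = Squarefree.squarefree-admissible n≢4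

-- Existence for the admissible moduli

-- Serves n = 2, 3, 4, where exchanging the exponents of 1 and j makes the power map the identity:
-- 1^j = 1, j^1 = j, and for n = 4 also 3^3 ≡ 3.
identity-powers : ∀ n .{{_ : NonZero n}} j → InRange n 1 → InRange n j →
  (∀ x → InRange n x → x ^ swap 1 j x % n ≡ x) → ExistsExpOrthomorphism n
identity-powers n j 1∈ j∈ fixed = swap 1 j ,
  injective⇒BijOn (λ x x∈ → swap-preserves (InRange n) 1∈ j∈ x∈) (λ x y _ _ → swap-injective 1 j) ,
  injective⇒BijOn (λ x x∈ → subst (InRange n) (sym (fixed x x∈)) x∈)
    (λ x y x∈ y∈ e → trans (sym (fixed x x∈)) (trans e (fixed y y∈)))

orthomorphism-2p : ∀ {p} → Prime p → Odd p → GoodPrimeShape p → .{{_ : NonZero (2 * p)}} → ExistsExpOrthomorphism (2 * p)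
orthomorphism-2p {p} pr p-odd (qs , prs , odds , u , p-1≡) =
  Construction.existsExpOrthomorphism p (product (2 ∷ qs)) (proj₁ g) pr p-odd
    (trans (sym (m+[n∸m]≡n (<⇒≤ (prime>1 pr)))) (cong suc p-1≡)) (proj₂ g)
    (squarefreeSystem primes unique)
  where
  -- The factor 2 of p - 1 is treated as one more prime, distinct from the odd ones, so the product
  -- is all of p - 1.
  primes : All Prime (2 ∷ qs)
  primes = prime[2] ∷ prs
  unique : Unique (2 ∷ qs)
  unique = All.map (λ odd 2≡q → odd (subst (2 ∣_) 2≡q ∣-refl)) odds ∷ u
  g : ∃[ g ] HasOrder p g (product (2 ∷ qs))
  g = ∃-squarefree-order pr primes unique (subst (product (2 ∷ qs) ∣_) (sym p-1≡) ∣-refl)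

sufficiency : ∀ n .{{_ : NonZero n}} → Admissible n → ExistsExpOrthomorphism n
sufficiency _ (inj₁ refl) = identity-powers 2 1 (s≤s z≤n , s≤s (s≤s z≤n)) (s≤s z≤n , s≤s (s≤s z≤n)) fixed
  where
  fixed : ∀ x → InRange 2 x → x ^ swap 1 1 x % 2 ≡ x
  fixed 1 _ = refl
  fixed (suc (suc _)) (_ , s≤s (s≤s ()))
sufficiency _ (inj₂ (inj₁ refl)) = identity-powers 3 2 (s≤s z≤n , s≤s (s≤s z≤n)) (s≤s z≤n , s≤s (s≤s (s≤s z≤n))) fixed
  where
  fixed : ∀ x → InRange 3 x → x ^ swap 1 2 x % 3 ≡ x
  fixed 1 _ = refl
  fixed 2 _ = refl
  fixed (suc (suc (suc _))) (_ , s≤s (s≤s (s≤s ())))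
sufficiency _ (inj₂ (inj₂ (inj₁ refl))) = identity-powers 4 2 (s≤s z≤n , s≤s (s≤s z≤n)) (s≤s z≤n , s≤s (s≤s (s≤s z≤n))) fixed
  where
  fixed : ∀ x → InRange 4 x → x ^ swap 1 2 x % 4 ≡ x
  fixed 1 _ = refl
  fixed 2 _ = refl
  fixed 3 _ = refl
  fixed (suc (suc (suc (suc _)))) (_ , s≤s (s≤s (s≤s (s≤s ()))))
sufficiency _ (inj₂ (inj₂ (inj₂ (p , pr , p-odd , shape , refl)))) = orthomorphism-2p pr p-odd shape

theorem1p4 : (n : ℕ) .{{_ : NonZero n}} → 2 ≤ n → (ExistsExpOrthomorphism n ⇔ Admissible n)
theorem1p4 n 2≤n = mk⇔ necessary (sufficiency n)
  where
  necessary : ExistsExpOrthomorphism n → Admissible n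
  necessary (σ , isOrth) = Necessity.admissible (>-nonZero (<-trans z<s 2≤n)) 2≤n σ isOrth
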